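{- There is an algorithm that, given a set $\mathcal{R}$ of rules on a finite ground set $Q$ and a rule $(A,q)$, decides whether $(A,q)$ is an implicate of $\mathcal{A}(\mathcal{R})$ in linear time, i.e. in time $O(l(\mathcal{R}))$.
   Context: A rule on $Q$ is a pair $(A,q)$ with $A\subseteq Q$, $q\in Q$; it accepts $X\subseteq Q$ if $q\in X$ implies $X\cap A\neq\emptyset$. For a set $\mathcal{R}$ of rules, $\mathcal{K}(\mathcal{R})$ is the family of subsets of $Q$ accepted by all rules in $\mathcal{R}$. A tight path from $\emptyset$ to $X$ in a family $\mathcal{K}$ is a sequence $\emptyset=Y_0\subseteq\dots\subseteq Y_k=X$ of members of $\mathcal{K}$ with $|Y_{i+1}\setminus Y_i|=1$. $\mathcal{A}(\mathcal{R})$ is the family of $K\in\mathcal{K}(\mathcal{R})$ such that there is a tight path from $\emptyset$ to $K$ in $\mathcal{K}(\mathcal{R})$. A rule $(A,q)$ is an implicate of a family $\mathcal{F}$ if it accepts every member of $\mathcal{F}$. The input size is $l(\mathcal{R})=\sum_{(A,q)\in\mathcal{R}}(|A|+1)$, assumed to satisfy $l(\mathcal{R})\ge|Q|$. -}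

module Defs where

open import Data.Bool.Base using (Bool; true; false; if_then_else_)
open import Data.Fin.Base using (Fin; toℕ)
open import Data.Fin.Subset using (Subset; Nonempty; _∈_; _⊆_; _∩_; _─_; ∣_∣; ⊥)
open import Data.List.Base using (List; []; _∷_; _++_; length; map; sum)
open import Data.List.Membership.Propositional using () renaming (_∈_ to _∈ˡ_)
open import Data.List.Relation.Unary.All using (All)
open import Data.List.Relation.Unary.Unique.Propositional using (Unique)
open import Data.Nat.Base using (ℕ; zero; suc; pred; _+_; _≡ᵇ_; _<ᵇ_)
open import Data.Product.Base using (_×_; _,_; proj₁)
open import Function.Bundles using (_⇔_)
open import Level using (0ℓ)
open import Relation.Binary.PropositionalEquality.Core using (_≡_)
open import Relation.Nullary.Negation.Core using (¬_)
open import Relation.Unary using (Pred)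

Rule : ℕ → Set
Rule n = Subset n × Fin n

Family : ℕ → Set₁
Family n = Pred (Subset n) 0ℓ

_Accepts_ : ∀ {n} → Rule n → Subset n → Set
(A , q) Accepts X = q ∈ X → Nonempty (X ∩ A)

𝓚 : ∀ {n} → List (Rule n) → Family n
𝓚 R X = All (_Accepts X) R

-- Sequences ∅ = Y₀ ⊆ … ⊆ Yₖ = X, built by appending the last set.
data TightPath {n} (𝓕 : Family n) : Subset n → Set where
  start : 𝓕 ⊥ → TightPath 𝓕 ⊥
  step  : ∀ {Y X} → TightPath 𝓕 Y → 𝓕 X → Y ⊆ X → ∣ X ─ Y ∣ ≡ 1 →
          TightPath 𝓕 X

𝓐 : ∀ {n} → List (Rule n) → Family n
𝓐 R K = 𝓚 R K × TightPath (𝓚 R) K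

Implicate : ∀ {n} → Family n → Rule n → Set
Implicate 𝓕 r = ∀ X → 𝓕 X → r Accepts X

size : ∀ {n} → List (Rule n) → ℕ
size R = sum (map (λ r → suc ∣ proj₁ r ∣) R)

-- A uniform-cost RAM, programmed with while-programs. Memory consists of
-- registers and of arrays, both indexed by ℕ; a program mentions only
-- finitely many of each. Apart from literals, the only arithmetic is
-- successor and predecessor: within t steps no word can exceed the largest
-- literal or input word by more than t. Thus in linear time all words and
-- addresses have logarithmically many bits, and unit cost is not abused by
-- large numbers. A conventional RAM simulates each step in constant time,
-- interleaving the finitely many arrays of the program in one memory.

record State : Set where
  constructor state
  field
    reg : ℕ → ℕ
    arr : ℕ → ℕ → ℕ

open State public

update : ∀ {B : Set} → ℕ → B → (ℕ → B) → ℕ → B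
update i v f j = if j ≡ᵇ i then v else f j

infix 5 _≔const_ _≔_ _≔suc_ _≔pred_ _≔_[_] _[_]≔_ _==_ _<<_
infixr 3 _⨾_

data Instruction : Set where
  _≔const_ : (x k : ℕ) → Instruction
  _≔_      : (x y : ℕ) → Instruction
  _≔suc_   : (x y : ℕ) → Instruction
  _≔pred_  : (x y : ℕ) → Instruction
  _≔_[_]   : (x a y : ℕ) → Instruction
  _[_]≔_   : (a x y : ℕ) → Instruction

-- Here x and y name registers, a names an array and k is a literal.
perform : Instruction → State → State
perform (x ≔const k) (state ρ μ) = state (update x k ρ) μ
perform (x ≔ y)      (state ρ μ) = state (update x (ρ y) ρ) μ
perform (x ≔suc y)   (state ρ μ) = state (update x (suc (ρ y)) ρ) μ
perform (x ≔pred y)  (state ρ μ) = state (update x (pred (ρ y)) ρ) μ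
perform (x ≔ a [ y ]) (state ρ μ) = state (update x (μ a (ρ y)) ρ) μ
perform (a [ x ]≔ y) (state ρ μ) =
  state ρ (update a (update (ρ x) (ρ y) (μ a)) μ)

data Test : Set where
  _==_ : (x y : ℕ) → Test
  _<<_ : (x y : ℕ) → Test

holds : Test → State → Bool
holds (x == y) s = reg s x ≡ᵇ reg s y
holds (x << y) s = reg s x <ᵇ reg s y

data Program : Set where
  skip  : Program
  exec  : Instruction → Program
  _⨾_   : Program → Program → Program
  cond  : Test → Program → Program → Program
  while : Test → Program → Program

-- ⟨ p , s ⟩⇓[ t ] s′: started in s, the program p halts in s′ after exactly
-- t steps, a step being an instruction or the evaluation of a test.
data ⟨_,_⟩⇓[_]_ : Program → State → ℕ → State → Set where
  skip        : ∀ {s} → ⟨ skip , s ⟩⇓[ 0 ] s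
  exec        : ∀ {i s} → ⟨ exec i , s ⟩⇓[ 1 ] perform i s
  _⨾_         : ∀ {p q s s′ s″ t u} →
                ⟨ p , s ⟩⇓[ t ] s′ → ⟨ q , s′ ⟩⇓[ u ] s″ →
                ⟨ p ⨾ q , s ⟩⇓[ t + u ] s″
  cond-true   : ∀ {b p q s s′ t} → holds b s ≡ true →
                ⟨ p , s ⟩⇓[ t ] s′ → ⟨ cond b p q , s ⟩⇓[ suc t ] s′
  cond-false  : ∀ {b p q s s′ t} → holds b s ≡ false →
                ⟨ q , s ⟩⇓[ t ] s′ → ⟨ cond b p q , s ⟩⇓[ suc t ] s′
  while-true  : ∀ {b p s s′ s″ t u} → holds b s ≡ true →
                ⟨ p , s ⟩⇓[ t ] s′ → ⟨ while b p , s′ ⟩⇓[ u ] s″ →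
                ⟨ while b p , s ⟩⇓[ suc (t + u) ] s″
  while-false : ∀ {b p s} → holds b s ≡ false →
                ⟨ while b p , s ⟩⇓[ 1 ] s

-- A set is presented to the machine by listing its elements without
-- repetition, in arbitrary order.
Enumerates : ∀ {n} → List (Fin n) → Subset n → Set
Enumerates xs A = Unique xs × (∀ x → x ∈ˡ xs ⇔ x ∈ A)

data EncodesRule {n} : List ℕ → Rule n → Set where
  rule : ∀ {xs A q} → Enumerates xs A →
         EncodesRule (toℕ q ∷ length xs ∷ map toℕ xs) (A , q)

data EncodesRules {n} : List ℕ → List (Rule n) → Set where
  []  : EncodesRules [] []
  _∷_ : ∀ {u v r R} → EncodesRule u r → EncodesRules v R →
        EncodesRules (u ++ v) (r ∷ R)

data EncodesInput {n} : List ℕ → List (Rule n) → Rule n → Set where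
  input : ∀ {u v R r} → EncodesRules u R → EncodesRule v r →
          EncodesInput (n ∷ length R ∷ u ++ v) R r

word : List ℕ → ℕ → ℕ
word []      i       = 0
word (x ∷ w) zero    = x
word (x ∷ w) (suc i) = word w i

-- The input is stored in array 0; everything else is zero.
initial : List ℕ → State
initial w = state (λ _ → 0) (update 0 (word w) (λ _ _ → 0))

data Answers (P : Set) : ℕ → Set where
  yes : P → Answers P 1
  no  : ¬ P → Answers P 0

output : State → ℕ
output s = reg s 0

{-# OPTIONS --safe #-}

-- The elements of the members of 𝓐 R avoiding A are the reachable ones, where
-- x ∉ A is reachable if every rule (B , x) of R has x ∈ B or a reachable element
-- in B. Indeed, a tight path adds elements one at a time, and conversely every
-- member avoiding A can be extended to one containing a given reachable element.
-- Hence (A , q) is an implicate exactly if q is not reachable. Reachability is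
-- computed in linear time as in Horn satisfiability: count[x] is the number of
-- unsatisfied rules with head x, an element whose counter is 0 is stacked, and
-- popping y satisfies the rules listed for y. The elements of A are blocked by
-- rules with empty body.

module Submission where

open import Defs
open import Data.Bool.Base using (Bool; true; false; if_then_else_; _∨_)
open import Data.Bool.Properties using (∨-conicalˡ; ∨-conicalʳ)
import Data.Empty as Empty
open import Data.Fin.Base using (Fin; toℕ)
import Data.Fin.Properties as Fin
open import Data.Fin.Subset using (Subset; Nonempty; _∈_; _∉_; _⊆_; _∪_; _∩_; _─_; _-_;
  ⁅_⁆; ∣_∣; ⊥)
import Data.Fin.Subset.Properties as Sub
open import Data.List.Base using (List; []; _∷_; _++_; _ʳ++_; length; map)
import Data.List.Properties as List
open import Data.List.Membership.Propositional using () renaming (_∈_ to _∈ˡ_)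
open import Data.List.Membership.Propositional.Properties
  using (∈-++⁻; ∈-++⁺ˡ; ∈-++⁺ʳ; ∈-map⁻; ∈-map⁺)
open import Data.List.Relation.Unary.All as All using (All; []; _∷_)
open import Data.List.Relation.Unary.AllPairs using ([]; _∷_)
open import Data.List.Relation.Unary.Any using (here; there)
import Data.List.Relation.Unary.Any.Properties as Any
open import Data.List.Relation.Unary.Unique.Propositional using (Unique)
open import Data.Nat.Base using (ℕ; zero; suc; pred; _+_; _*_; _≤_; _<_; z≤n; s≤s;
  _≡ᵇ_; _<ᵇ_; >-nonZero)
open import Data.Nat.ListAction using (sum)
import Data.Nat.Properties as ℕ
open import Data.Nat.Tactic.RingSolver using (solve-∀)
open import Data.Product.Base using (_×_; _,_; proj₁; proj₂; ∃-syntax)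
open import Data.Sum.Base as Sum using (_⊎_; inj₁; inj₂)
open import Data.Unit.Base using (⊤; tt)
open import Function.Base using (_∘_; id)
open import Function.Bundles using (_⇔_; mk⇔; Equivalence)
open import Relation.Binary.PropositionalEquality hiding ([_])
import Relation.Nullary.Decidable.Core as Dec
open import Relation.Nullary.Negation.Core using (¬_; contradiction)
open Equivalence using (to; from)

-- Reachability

-- A tight path adds one element at a time, so when `x` enters, a rule `(B , x)` is met either by an
-- older element of `B` or by `x` itself. This is the source of the disjunct `x ∈ B` in `Reachable`.
-- It is also why a rule containing its own head must stay out of the counters: counted, it would
-- hold `x` back until another element of `B` is reached. Conversely, acceptance of a rule whose
-- head is already present survives the addition of elements, so the supports of all rules with head
-- `x` can be collected one after another along a single growing path. A rule `(⊥ , a)` owns no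
-- node, so no visit ever closes it and the counter of `a` never falls to 0. For the time bound, a
-- rule may be met once for each element of its body but is closed only at the first meeting, and an
-- element is stacked only at the moment when its counter is found to be 0. Every node is therefore
-- visited at most once.

Disjoint : ∀ {n} → Subset n → Subset n → Set
Disjoint X A = ∀ {x} → x ∈ X → x ∉ A

-- A member of 𝓚 R avoiding A is the same as a set accepted by all of these
-- rules: the rule (∅ , a) forbids a.
data Constraint {n} (R : List (Rule n)) (A : Subset n) : Rule n → Set where
  given  : ∀ {r} → r ∈ˡ R → Constraint R A r
  forbid : ∀ {x} → x ∈ A → Constraint R A (⊥ , x)

data Reachable {n} (P : Rule n → Set) (x : Fin n) : Set where
  reach : (∀ {B} → P (B , x) → x ∈ B ⊎ ∃[ y ] (y ∈ B × Reachable P y)) →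
          Reachable P x

card-1-unique : ∀ {n} {p : Subset n} {x y} → ∣ p ∣ ≡ 1 → x ∈ p → y ∈ p → x ≡ y
card-1-unique {p = p} {x} {y} c x∈p y∈p with x Fin.≟ y
... | Dec.yes x≡y = x≡y
... | Dec.no x≢y = contradiction
  (ℕ.<-≤-trans (ℕ.≤-<-trans z≤n (Sub.x∈p⇒∣p-x∣<∣p∣ y∈p-x))
    (ℕ.≤-pred (subst (∣ p - x ∣ <_) c (Sub.x∈p⇒∣p-x∣<∣p∣ x∈p))))
  (ℕ.<-irrefl refl)
  where y∈p-x = Sub.x∈p∧x≢y⇒x∈p-y y∈p (x≢y ∘ sym)

-- Subtracting `q` a second time changes nothing, yet a common element would make the cardinality
-- drop strictly.
x∈p─q⇒x∉q : ∀ {n} (p q : Subset n) {x} → x ∈ p ─ q → x ∉ q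
x∈p─q⇒x∉q p q x∈p─q x∈q = ℕ.<-irrefl (cong ∣_∣ (Sub.p─q─q≡p─q p q))
  (Sub.p∩q≢∅⇒∣p─q∣<∣p∣ (p ─ q) q (_ , Sub.x∈p∩q⁺ (x∈p─q , x∈q)))

∩-monoˡ-Nonempty : ∀ {n} {X Y : Subset n} B → X ⊆ Y → Nonempty (X ∩ B) → Nonempty (Y ∩ B)
∩-monoˡ-Nonempty {X = X} B X⊆Y (w , w∈) with Sub.x∈p∩q⁻ X B w∈
... | w∈X , w∈B = w , Sub.x∈p∩q⁺ (X⊆Y w∈X , w∈B)

module _ {n} (R : List (Rule n)) (A : Subset n) where

  Support : Fin n → Subset n → Set
  Support x B = x ∈ B ⊎ ∃[ y ] (y ∈ B × Reachable (Constraint R A) y)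

  path-end : ∀ {X} → TightPath (𝓚 R) X → 𝓚 R X
  path-end (start k)      = k
  path-end (step _ k _ _) = k

  -- A new `x` is the only element of `X ─ Y`. Whatever meets a rule with head `x` is thus older,
  -- and reachable by induction, or is `x` itself.
  path⇒reachable : ∀ {X} → TightPath (𝓚 R) X → Disjoint X A →
                   ∀ {x} → x ∈ X → Reachable (Constraint R A) x
  path⇒reachable (start _) dis x∈⊥ = contradiction x∈⊥ Sub.∉⊥
  path⇒reachable (step {Y} {X} path k Y⊆X one) dis {x} x∈X with x Sub.∈? Y
  ... | Dec.yes x∈Y = path⇒reachable path (dis ∘ Y⊆X) x∈Y
  ... | Dec.no x∉Y = reach support
    where
    support : ∀ {B} → Constraint R A (B , x) → Support x B
    support (forbid x∈A) = contradiction x∈A (dis x∈X)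
    support {B} (given r∈R) with All.lookup k r∈R x∈X
    ... | y , y∈X∩B with Sub.x∈p∩q⁻ X B y∈X∩B
    ... | y∈X , y∈B with y Sub.∈? Y
    ... | Dec.yes y∈Y = inj₂ (y , y∈B , path⇒reachable path (dis ∘ Y⊆X) y∈Y)
    ... | Dec.no y∉Y = inj₁ (subst (_∈ B)
      (card-1-unique one (Sub.x∈p∧x∉q⇒x∈p─q y∈X y∉Y) (Sub.x∈p∧x∉q⇒x∈p─q x∈X x∉Y)) y∈B)

  -- Starting from an arbitrary `Y` rather than from the empty set lets extensions be chained, each
  -- keeping what the earlier ones gained.
  record Extension (Y : Subset n) : Set where
    field
      {set}    : Subset n
      path     : TightPath (𝓚 R) set
      disjoint : Disjoint set A
      extends  : Y ⊆ set

  open Extension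

  extend-by : ∀ {Y} → TightPath (𝓚 R) Y → Disjoint Y A → ∀ {x} → x ∉ A →
              (∀ {B} → (B , x) ∈ˡ R → x ∈ B ⊎ Nonempty (Y ∩ B)) →
              ∃[ E ] x ∈ set {Y} E
  extend-by {Y} tight dis {x} x∉A support with x Sub.∈? Y
  ... | Dec.yes x∈Y = record { path = tight ; disjoint = dis ; extends = id } , x∈Y
  ... | Dec.no x∉Y = record
    { path = step tight (All.tabulate accepts) (Sub.p⊆p∪q ⁅ x ⁆)
        (trans (cong ∣_∣ difference) (Sub.∣⁅x⁆∣≡1 x))
    ; disjoint = λ {z} z∈Y′ → disjoint′ (Sub.x∈p∪q⁻ Y ⁅ x ⁆ z∈Y′)
    ; extends = Sub.p⊆p∪q ⁅ x ⁆ } , x∈Y′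
    where
    Y′ = Y ∪ ⁅ x ⁆

    x∈Y′ : x ∈ Y′
    x∈Y′ = Sub.q⊆p∪q Y ⁅ x ⁆ (Sub.x∈⁅x⁆ x)

    disjoint′ : ∀ {z} → z ∈ Y ⊎ z ∈ ⁅ x ⁆ → z ∉ A
    disjoint′ (inj₁ z∈Y) = dis z∈Y
    disjoint′ (inj₂ z∈x) = subst (_∉ A) (sym (Sub.x∈⁅y⁆⇒x≡y x z∈x)) x∉A

    difference : Y′ ─ Y ≡ ⁅ x ⁆
    difference = Sub.⊆-antisym
      (λ {z} z∈ → pick z∈ (Sub.x∈p∪q⁻ Y ⁅ x ⁆ (Sub.p─q⊆p Y′ Y z∈)))
      (λ {z} z∈x → Sub.x∈p∧x∉q⇒x∈p─q (Sub.q⊆p∪q Y ⁅ x ⁆ z∈x)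
                     (subst (_∉ Y) (sym (Sub.x∈⁅y⁆⇒x≡y x z∈x)) x∉Y))
      where
      pick : ∀ {z} → z ∈ Y′ ─ Y → z ∈ Y ⊎ z ∈ ⁅ x ⁆ → z ∈ ⁅ x ⁆
      pick z∈ (inj₁ z∈Y) = contradiction z∈Y (x∈p─q⇒x∉q Y′ Y z∈)
      pick _  (inj₂ z∈x) = z∈x

    accepts : ∀ {r} → r ∈ˡ R → r Accepts Y′
    accepts {B , z} r∈R z∈Y′ with Sub.x∈p∪q⁻ Y ⁅ x ⁆ z∈Y′
    ... | inj₁ z∈Y = ∩-monoˡ-Nonempty B (Sub.p⊆p∪q ⁅ x ⁆) (All.lookup (path-end tight) r∈R z∈Y)
    accepts {B , z} r∈R z∈Y′ | inj₂ z∈x with Sub.x∈⁅y⁆⇒x≡y x z∈x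
    ... | refl with support r∈R
    ... | inj₁ x∈B = x , Sub.x∈p∩q⁺ (x∈Y′ , x∈B)
    ... | inj₂ ne = ∩-monoˡ-Nonempty B (Sub.p⊆p∪q ⁅ x ⁆) ne

  reachable⇒∉ : ∀ {x} → Reachable (Constraint R A) x → x ∉ A
  reachable⇒∉ (reach support) x∈A with support (forbid x∈A)
  ... | inj₁ x∈⊥ = Sub.∉⊥ x∈⊥
  ... | inj₂ (_ , y∈⊥ , _) = Sub.∉⊥ y∈⊥

  mutual
    extend-to : ∀ {Y} → TightPath (𝓚 R) Y → Disjoint Y A →
                ∀ {x} → Reachable (Constraint R A) x → ∃[ E ] x ∈ set {Y} E
    extend-to tight dis {x} (reach support)
      with E , sup ← support-all tight dis support R given
      with F , x∈ ← extend-by (path E) (disjoint E) (reachable⇒∉ (reach support)) sup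
      = record { path = path F ; disjoint = disjoint F ; extends = extends F ∘ extends E } , x∈

    -- `L` stands for the part of `R` still to be treated. Each body that needs an element enlarges
    -- the set, and supports found earlier persist by monotonicity. The call back to `extend-to` is
    -- on a subproof of `support`.
    support-all : ∀ {Y} → TightPath (𝓚 R) Y → Disjoint Y A → ∀ {x} →
                  (∀ {B} → Constraint R A (B , x) → Support x B) →
                  ∀ (L : List (Rule n)) → (∀ {r} → r ∈ˡ L → Constraint R A r) →
                  ∃[ E ] (∀ {B} → (B , x) ∈ˡ L → x ∈ B ⊎ Nonempty (set {Y} E ∩ B))
    support-all tight dis support [] _ =
      record { path = tight ; disjoint = dis ; extends = id } , λ ()
    support-all tight dis {x} support ((B , z) ∷ L) L⊆
      with E , sup ← support-all tight dis support L (L⊆ ∘ there) with z Fin.≟ x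
    ... | Dec.no z≢x = E , λ { (here refl) → contradiction refl z≢x ; (there r∈L) → sup r∈L }
    ... | Dec.yes refl with support (L⊆ (here refl))
    ...   | inj₁ x∈B = E , λ { (here refl) → inj₁ x∈B ; (there r∈L) → sup r∈L }
    ...   | inj₂ (y , y∈B , reachable)
      with F , y∈F ← extend-to (path E) (disjoint E) reachable
      = record { path = path F ; disjoint = disjoint F ; extends = extends F ∘ extends E } ,
        λ { (here refl)  → inj₂ (y , Sub.x∈p∩q⁺ (y∈F , y∈B))
          ; {C} (there r∈L) → Sum.map₂ (∩-monoˡ-Nonempty C (extends F)) (sup r∈L) }

  reachable⇒¬implicate : ∀ {q} → Reachable (Constraint R A) q → ¬ Implicate (𝓐 R) (A , q)
  reachable⇒¬implicate reachable implicate
    with E , q∈ ← extend-to (start (All.tabulate λ _ q∈⊥ → contradiction q∈⊥ Sub.∉⊥))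
                            (λ x∈⊥ → contradiction x∈⊥ Sub.∉⊥) reachable
    with x , x∈ ← implicate (set E) (path-end (path E) , path E) q∈
    with x∈X , x∈A ← Sub.x∈p∩q⁻ (set E) A x∈
    = disjoint E x∈X x∈A

  ¬reachable⇒implicate : ∀ {q} → ¬ Reachable (Constraint R A) q → Implicate (𝓐 R) (A , q)
  ¬reachable⇒implicate ¬reachable X (_ , path) q∈X with Sub.nonempty? (X ∩ A)
  ... | Dec.yes ne = ne
  ... | Dec.no ¬ne = contradiction
    (path⇒reachable path (λ x∈X x∈A → ¬ne (_ , Sub.x∈p∩q⁺ (x∈X , x∈A))) q∈X) ¬reachable

-- Updates and sums

≡ᵇ-refl : ∀ m → (m ≡ᵇ m) ≡ true
≡ᵇ-refl zero    = refl
≡ᵇ-refl (suc m) = ≡ᵇ-refl m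

≢⇒≡ᵇ : ∀ m n → m ≢ n → (m ≡ᵇ n) ≡ false
≢⇒≡ᵇ zero    zero    m≢n = contradiction refl m≢n
≢⇒≡ᵇ zero    (suc n) m≢n = refl
≢⇒≡ᵇ (suc m) zero    m≢n = refl
≢⇒≡ᵇ (suc m) (suc n) m≢n = ≢⇒≡ᵇ m n (m≢n ∘ cong suc)

module _ {B : Set} {v : B} (f : ℕ → B) where

  update-same : ∀ i → update i v f i ≡ v
  update-same i rewrite ≡ᵇ-refl i = refl

  update-other : ∀ {i j} → j ≢ i → update i v f j ≡ f j
  update-other {i} {j} j≢i rewrite ≢⇒≡ᵇ j i j≢i = refl

∑ : ℕ → (ℕ → ℕ) → ℕ
∑ zero    f = 0
∑ (suc N) f = f N + ∑ N f

∑-cong : ∀ N {f g} → (∀ i → i < N → f i ≡ g i) → ∑ N f ≡ ∑ N g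
∑-cong zero    f≗g = refl
∑-cong (suc N) f≗g = cong₂ _+_ (f≗g N ℕ.≤-refl) (∑-cong N λ i i<N → f≗g i (ℕ.m<n⇒m<1+n i<N))

∑-zero : ∀ N {f} → (∀ i → i < N → f i ≡ 0) → ∑ N f ≡ 0
∑-zero zero    f≗0 = refl
∑-zero (suc N) f≗0 = cong₂ _+_ (f≗0 N ℕ.≤-refl) (∑-zero N λ i i<N → f≗0 i (ℕ.m<n⇒m<1+n i<N))

∑-zero⁻ : ∀ N {f} → ∑ N f ≡ 0 → ∀ {i} → i < N → f i ≡ 0
∑-zero⁻ (suc N) {f} eq {i} i<1+N with i ℕ.≟ N
... | Dec.yes refl = ℕ.m+n≡0⇒m≡0 (f i) eq
... | Dec.no i≢N = ∑-zero⁻ N (ℕ.m+n≡0⇒n≡0 (f N) eq) (ℕ.≤∧≢⇒< (ℕ.≤-pred i<1+N) i≢N)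

∑-extend : ∀ {M N f} → (∀ i → M ≤ i → f i ≡ 0) → M ≤ N → ∑ N f ≡ ∑ M f
∑-extend {N = zero}  f≗0 z≤n = refl
∑-extend {M} {suc N} f≗0 M≤N with ℕ.m≤n⇒m<n∨m≡n M≤N
... | inj₂ refl = refl
... | inj₁ (s≤s M≤N′) = cong₂ _+_ (f≗0 N M≤N′) (∑-extend f≗0 M≤N′)

-- Replacing one term of a sum, with the two exchanged terms moved across the equation to avoid
-- truncated subtraction.
∑-replace : ∀ N {f g k} → k < N → (∀ i → i ≢ k → f i ≡ g i) → ∑ N f + g k ≡ ∑ N g + f k
∑-replace (suc N) {f} {g} {k} k<1+N f≗g with k ℕ.≟ N
... | Dec.yes refl rewrite ∑-cong k {f} {g} (λ i i<k → f≗g i (ℕ.<⇒≢ i<k)) =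
  trans (ℕ.+-assoc (f k) _ _) (trans (ℕ.+-comm (f k) _) (cong (_+ f k) (ℕ.+-comm _ (g k))))
... | Dec.no k≢N = trans (ℕ.+-assoc (f N) _ _)
  (trans (cong₂ _+_ (f≗g N (k≢N ∘ sym)) (∑-replace N (ℕ.≤∧≢⇒< (ℕ.≤-pred k<1+N) k≢N) f≗g))
         (sym (ℕ.+-assoc (g N) _ _)))

-- Bounded runs and what they preserve

-- A total-correctness triple with a time budget. The budget is an inequality, so branches of
-- different lengths can share it.
record Run (p : Program) (s : State) (b : ℕ) (Q : State → Set) : Set where
  constructor run
  field
    {time}  : ℕ
    {final} : State
    trace   : ⟨ p , s ⟩⇓[ time ] final
    bound   : time ≤ b
    post    : Q final

module _ {s : State} where

  halt : ∀ {Q : State → Set} → Q s → Run skip s 0 Q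
  halt q = run skip z≤n q

  stop : ∀ {i} {Q : State → Set} → Q (perform i s) → Run (exec i) s 1 Q
  stop q = run exec ℕ.≤-refl q

  infixr 2 ▸_ _▹_

  ▸_ : ∀ {i p b Q} → Run p (perform i s) b Q → Run (exec i ⨾ p) s (suc b) Q
  ▸ run t b q = run (exec ⨾ t) (s≤s b) q

  -- The continuation receives the trace as well as the postcondition. The frame lemmas then recover
  -- from it whatever the first program leaves untouched, and postconditions need only mention what
  -- changes.
  _▹_ : ∀ {p p′ b b′ Q Q′} → Run p s b Q →
        (∀ {t s′} → ⟨ p , s ⟩⇓[ t ] s′ → Q s′ → Run p′ s′ b′ Q′) →
        Run (p ⨾ p′) s (b + b′) Q′
  run t b q ▹ f with run t′ b′ q′ ← f t q = run (t ⨾ t′) (ℕ.+-mono-≤ b b′) q′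

  then-run : ∀ {c p p′ b Q} → holds c s ≡ true → Run p s b Q → Run (cond c p p′) s (suc b) Q
  then-run h (run t b q) = run (cond-true h t) (s≤s b) q

  else-run : ∀ {c p p′ b Q} → holds c s ≡ false → Run p′ s b Q → Run (cond c p p′) s (suc b) Q
  else-run h (run t b q) = run (cond-false h t) (s≤s b) q

  loop-end : ∀ {c p Q} → holds c s ≡ false → Q s → Run (while c p) s 1 Q
  loop-end h q = run (while-false h) ℕ.≤-refl q

  loop-step : ∀ {c p b b′ Q Q′} → holds c s ≡ true → Run p s b Q →
              (∀ {t s′} → ⟨ p , s ⟩⇓[ t ] s′ → Q s′ → Run (while c p) s′ b′ Q′) →
              Run (while c p) s (suc (b + b′)) Q′
  loop-step h (run t b q) f with run t′ b′ q′ ← f t q =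
    run (while-true h t t′) (s≤s (ℕ.+-mono-≤ b b′)) q′

  within : ∀ {p b b′ Q} → b ≤ b′ → Run p s b Q → Run p s b′ Q
  within b≤b′ (run t b q) = run t (ℕ.≤-trans b b≤b′) q

  refine : ∀ {p b Q Q′} → Run p s b Q → (∀ {t s′} → ⟨ p , s ⟩⇓[ t ] s′ → Q s′ → Q′ s′) →
           Run p s b Q′
  refine (run t b q) f = run t b (f t q)

instruction-sets : ℕ → Instruction → Bool
instruction-sets z (x ≔const _)  = z ≡ᵇ x
instruction-sets z (x ≔ _)       = z ≡ᵇ x
instruction-sets z (x ≔suc _)    = z ≡ᵇ x
instruction-sets z (x ≔pred _)   = z ≡ᵇ x
instruction-sets z (x ≔ _ [ _ ]) = z ≡ᵇ x
instruction-sets z (_ [ _ ]≔ _)  = false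

instruction-writes : ℕ → Instruction → Bool
instruction-writes c (a [ _ ]≔ _) = c ≡ᵇ a
instruction-writes c _            = false

mentions : (Instruction → Bool) → Program → Bool
mentions P skip         = false
mentions P (exec i)     = P i
mentions P (p ⨾ q)      = mentions P p ∨ mentions P q
mentions P (cond _ p q) = mentions P p ∨ mentions P q
mentions P (while _ p)  = mentions P p

-- The side condition is a syntactic check that computes on closed programs, so that `refl` proves
-- it at every use.
preserves : ∀ {B : Set} {P : Instruction → Bool} (π : State → B) →
            (∀ i s → P i ≡ false → π (perform i s) ≡ π s) →
            ∀ {p s t s′} → ⟨ p , s ⟩⇓[ t ] s′ → mentions P p ≡ false → π s′ ≡ π s
preserves π h skip m = refl
preserves π h exec m = h _ _ m
preserves {P = P} π h (_⨾_ {p} {q} t u) m =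
  trans (preserves π h u (∨-conicalʳ (mentions P p) _ m)) (preserves π h t (∨-conicalˡ _ _ m))
preserves π h (cond-true _ t) m = preserves π h t (∨-conicalˡ _ _ m)
preserves {P = P} π h (cond-false {p = p} _ t) m = preserves π h t (∨-conicalʳ (mentions P p) _ m)
preserves π h (while-true _ t u) m = trans (preserves π h u m) (preserves π h t m)
preserves π h (while-false _) m = refl

reg-frame : ∀ {p s t s′} x → ⟨ p , s ⟩⇓[ t ] s′ → mentions (instruction-sets x) p ≡ false →
            reg s′ x ≡ reg s x
reg-frame z = preserves (λ s → reg s z) unset
  where
  unset : ∀ i s → instruction-sets z i ≡ false → reg (perform i s) z ≡ reg s z
  unset (x ≔const _)  s eq rewrite eq = refl
  unset (x ≔ _)       s eq rewrite eq = refl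
  unset (x ≔suc _)    s eq rewrite eq = refl
  unset (x ≔pred _)   s eq rewrite eq = refl
  unset (x ≔ _ [ _ ]) s eq rewrite eq = refl
  unset (_ [ _ ]≔ _)  s eq = refl

arr-frame : ∀ {p s t s′} a → ⟨ p , s ⟩⇓[ t ] s′ → mentions (instruction-writes a) p ≡ false →
            arr s′ a ≡ arr s a
arr-frame c = preserves (λ s → arr s c) unwritten
  where
  unwritten : ∀ i s → instruction-writes c i ≡ false → arr (perform i s) c ≡ arr s c
  unwritten (_ ≔const _)  s eq = refl
  unwritten (_ ≔ _)       s eq = refl
  unwritten (_ ≔suc _)    s eq = refl
  unwritten (_ ≔pred _)   s eq = refl
  unwritten (_ ≔ _ [ _ ]) s eq = refl
  unwritten (a [ x ]≔ _)  s eq rewrite eq = refl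

-- The program

-- Registers. The register ground is never written and thus holds 0. While a
-- rule is read, flag records whether its head occurs in its body; such a rule
-- never prevents an element from being added and is not opened.
out ground size-n rules pos origin target left item temp flag query top node : ℕ
out = 0 ; ground = 1 ; size-n = 2 ; rules = 3 ; pos = 4 ; origin = 5 ; target = 6
left = 7 ; item = 8 ; temp = 9 ; flag = 10 ; query = 11 ; top = 12 ; node = 13

-- Arrays. Each listed element of a rule is a node, addressed by its position
-- in the input; head[y] starts the list of the nodes with element y, linked
-- by next, and owner gives the position of the rule that a node belongs to.
-- At the position of an unsatisfied rule with head x, open-rule holds suc x;
-- elsewhere it holds 0.
tape head next owner open-rule count stack : ℕ
tape = 0 ; head = 1 ; next = 2 ; owner = 3 ; open-rule = 4 ; count = 5 ; stack = 6

linkItem : Program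
linkItem =
  exec (temp ≔ head [ item ]) ⨾
  exec (next [ pos ]≔ temp) ⨾
  exec (head [ item ]≔ pos) ⨾
  exec (owner [ pos ]≔ origin) ⨾
  exec (pos ≔suc pos) ⨾
  exec (left ≔pred left)

scanItem : Program
scanItem =
  exec (item ≔ tape [ pos ]) ⨾
  cond (item == target) (exec (flag ≔const 1)) skip ⨾
  linkItem

openRule : Program
openRule =
  exec (temp ≔suc target) ⨾
  exec (open-rule [ origin ]≔ temp) ⨾
  exec (temp ≔ count [ target ]) ⨾
  exec (temp ≔suc temp) ⨾
  exec (count [ target ]≔ temp)

scanRule : Program
scanRule =
  exec (origin ≔ pos) ⨾
  exec (target ≔ tape [ pos ]) ⨾
  exec (pos ≔suc pos) ⨾
  exec (left ≔ tape [ pos ]) ⨾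
  exec (pos ≔suc pos) ⨾
  exec (flag ≔const 0) ⨾
  while (ground << left) scanItem ⨾
  cond (flag == ground) openRule skip ⨾
  exec (rules ≔pred rules)

forbidItem : Program
forbidItem =
  exec (origin ≔ pos) ⨾
  exec (target ≔ tape [ pos ]) ⨾
  exec (pos ≔suc pos) ⨾
  exec (left ≔pred left) ⨾
  openRule

readInput : Program
readInput =
  exec (size-n ≔ tape [ pos ]) ⨾
  exec (pos ≔suc pos) ⨾
  exec (rules ≔ tape [ pos ]) ⨾
  exec (pos ≔suc pos) ⨾
  while (ground << rules) scanRule ⨾
  exec (query ≔ tape [ pos ]) ⨾
  exec (pos ≔suc pos) ⨾
  exec (left ≔ tape [ pos ]) ⨾
  exec (pos ≔suc pos) ⨾
  while (ground << left) forbidItem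

push : Program
push = exec (stack [ top ]≔ target) ⨾ exec (top ≔suc top)

pushZero : Program
pushZero =
  exec (temp ≔ count [ target ]) ⨾
  cond (temp == ground) push skip ⨾
  exec (target ≔suc target)

settleRule : Program
settleRule =
  exec (target ≔pred temp) ⨾
  exec (open-rule [ origin ]≔ ground) ⨾
  exec (temp ≔ count [ target ]) ⨾
  exec (temp ≔pred temp) ⨾
  exec (count [ target ]≔ temp) ⨾
  cond (temp == ground) push skip

visitNode : Program
visitNode =
  exec (origin ≔ owner [ node ]) ⨾
  exec (temp ≔ open-rule [ origin ]) ⨾
  cond (ground << temp) settleRule skip ⨾
  exec (node ≔ next [ node ])

visitElement : Program
visitElement =
  exec (top ≔pred top) ⨾
  exec (item ≔ stack [ top ]) ⨾
  exec (node ≔ head [ item ]) ⨾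
  while (ground << node) visitNode

saturate : Program
saturate =
  exec (target ≔const 0) ⨾
  while (target << size-n) pushZero ⨾
  while (ground << top) visitElement

answer : Program
answer =
  exec (temp ≔ count [ query ]) ⨾
  cond (temp == ground) (exec (out ≔const 0)) (exec (out ≔const 1))

decideImplicate : Program
decideImplicate = readInput ⨾ saturate ⨾ answer

-- Linked lists, stacks and counters

-- A list of incidences consists of pairs (y , s) such that y occurs in the body
-- of the rule at position s.
owners : List (ℕ × ℕ) → ℕ → List ℕ
owners []              z = []
owners ((y , s) ∷ inc) z = if z ≡ᵇ y then s ∷ owners inc z else owners inc z

∈-owners⁻ : ∀ inc {z s} → s ∈ˡ owners inc z → (z , s) ∈ˡ inc
∈-owners⁻ ((y , _) ∷ inc) {z} s∈ with z ℕ.≟ y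
... | Dec.no z≢y rewrite ≢⇒≡ᵇ z y z≢y = there (∈-owners⁻ inc s∈)
... | Dec.yes refl rewrite ≡ᵇ-refl z with s∈
...   | here refl = here refl
...   | there s∈′ = there (∈-owners⁻ inc s∈′)

∈-owners⁺ : ∀ {inc z s} → (z , s) ∈ˡ inc → s ∈ˡ owners inc z
∈-owners⁺ {(y , _) ∷ inc} (here refl) rewrite ≡ᵇ-refl y = here refl
∈-owners⁺ {(y , _) ∷ inc} {z} (there zs∈) with z ≡ᵇ y
... | true  = there (∈-owners⁺ zs∈)
... | false = ∈-owners⁺ zs∈

owners-same : ∀ y {s} inc → owners ((y , s) ∷ inc) y ≡ s ∷ owners inc y
owners-same y inc rewrite ≡ᵇ-refl y = refl

owners-other : ∀ {y z s} inc → z ≢ y → owners ((y , s) ∷ inc) z ≡ owners inc z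
owners-other {y} {z} inc z≢y rewrite ≢⇒≡ᵇ z y z≢y = refl

-- Each incidence lies in the list of its own element only. Those whose element is not below `n`
-- drop out of the sum, hence an inequality.
∑-owners : ∀ n inc → ∑ n (length ∘ owners inc) ≤ length inc
∑-owners n [] = ℕ.≤-reflexive (∑-zero n λ _ _ → refl)
∑-owners n ((y , s) ∷ inc) with y ℕ.<? n
... | Dec.no y≮n = ℕ.m≤n⇒m≤1+n (subst (_≤ length inc)
  (sym (∑-cong n λ z z<n → cong length (owners-other inc λ { refl → y≮n z<n }))) (∑-owners n inc))
... | Dec.yes y<n = subst (_≤ suc (length inc))
  (sym (ℕ.+-cancelʳ-≡ (length (owners inc y)) _ _
    (trans (∑-replace n y<n (λ z z≢y → cong length (owners-other inc z≢y)))
      (trans (cong (∑ n (length ∘ owners inc) +_) (cong length (owners-same y inc)))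
             (ℕ.+-suc _ _)))))
  (s≤s (∑-owners n inc))

-- A list linked by ν, with entries read off by ω. Addresses decrease along
-- the links, so that writing at a larger address leaves the list alone.
data Chain (ν ω : ℕ → ℕ) : ℕ → List ℕ → Set where
  []   : Chain ν ω 0 []
  link : ∀ {k k′ s ss} → ν k ≡ k′ → ω k ≡ s → k′ < k → Chain ν ω k′ ss → Chain ν ω k (s ∷ ss)

Chain-update : ∀ {ν ω p a b k ss} → k < p → Chain ν ω k ss →
               Chain (update p a ν) (update p b ω) k ss
Chain-update k<p [] = []
Chain-update {ν} {ω} k<p (link νk ωk k′<k chain) =
  link (trans (update-other ν (ℕ.<⇒≢ k<p)) νk) (trans (update-other ω (ℕ.<⇒≢ k<p)) ωk) k′<k
       (Chain-update (ℕ.<-trans k′<k k<p) chain)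

-- Here `p` is the next tape position to be read. By `fresh`, a node stored there has an address
-- above all those in use, as `Chain-update` requires. Address 0 marks the end of a list.
record Linked (η ν ω : ℕ → ℕ) (inc : List (ℕ × ℕ)) (p : ℕ) : Set where
  field
    chains : ∀ z → Chain ν ω (η z) (owners inc z)
    fresh  : ∀ z → η z < p

Linked-mono : ∀ {η ν ω inc p p′} → p ≤ p′ → Linked η ν ω inc p → Linked η ν ω inc p′
Linked-mono p≤p′ linked = record
  { chains = chains ; fresh = λ z → ℕ.<-≤-trans (fresh z) p≤p′ }
  where open Linked linked

Linked-insert : ∀ {η ν ω inc p} y s → Linked η ν ω inc p →
                Linked (update y p η) (update p (η y) ν) (update p s ω) ((y , s) ∷ inc) (suc p)
Linked-insert {η} {ν} {ω} {inc} {p} y s linked = record { chains = chains′ ; fresh = fresh′ }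
  where
  open Linked linked

  chains′ : ∀ z → Chain (update p (η y) ν) (update p s ω) (update y p η z)
                        (owners ((y , s) ∷ inc) z)
  chains′ z with z ℕ.≟ y
  ... | Dec.no z≢y rewrite ≢⇒≡ᵇ z y z≢y = Chain-update (fresh z) (chains z)
  ... | Dec.yes refl rewrite ≡ᵇ-refl z =
    link (update-same ν p) (update-same ω p) (fresh z) (Chain-update (fresh z) (chains z))

  fresh′ : ∀ z → update y p η z < suc p
  fresh′ z with z ≡ᵇ y
  ... | true  = ℕ.≤-refl
  ... | false = ℕ.m<n⇒m<1+n (fresh z)

data Stack (σ : ℕ → ℕ) : ℕ → List ℕ → Set where
  []  : Stack σ 0 []
  _∷_ : ∀ {k x xs} → σ k ≡ x → Stack σ k xs → Stack σ (suc k) (x ∷ xs)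

Stack-update : ∀ {σ p a k xs} → k ≤ p → Stack σ k xs → Stack (update p a σ) k xs
Stack-update k≤p [] = []
Stack-update {σ} k<p (top ∷ stack) =
  trans (update-other σ (ℕ.<⇒≢ k<p)) top ∷ Stack-update (ℕ.<⇒≤ k<p) stack

Stack-push : ∀ {σ k xs} x → Stack σ k xs → Stack (update k x σ) (suc k) (x ∷ xs)
Stack-push {σ} {k} x stack = update-same σ k ∷ Stack-update ℕ.≤-refl stack

Reads : (ℕ → ℕ) → ℕ → List ℕ → Set
Reads f p []      = ⊤
Reads f p (x ∷ u) = f p ≡ x × Reads f (suc p) u

Reads-word : ∀ f p u → (∀ i → f (i + p) ≡ word u i) → Reads f p u
Reads-word f p []      eq = tt
Reads-word f p (x ∷ u) eq =
  eq 0 , Reads-word f (suc p) u (λ i → trans (cong f (ℕ.+-suc i p)) (eq (suc i)))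

-- Here τ is the content of open-rule and κ is that of count.
opens : (ℕ → ℕ) → ℕ → ℕ → ℕ
opens τ x i = if τ i ≡ᵇ suc x then 1 else 0

opens-≡ : ∀ τ {x} i → τ i ≡ suc x → opens τ x i ≡ 1
opens-≡ τ {x} i eq rewrite eq | ≡ᵇ-refl x = refl

opens-≢ : ∀ τ {x} i → τ i ≢ suc x → opens τ x i ≡ 0
opens-≢ τ {x} i neq rewrite ≢⇒≡ᵇ (τ i) (suc x) neq = refl

Counts : ℕ → (ℕ → ℕ) → (ℕ → ℕ) → Set
Counts N τ κ = ∀ x → κ x ≡ ∑ N (opens τ x)

opens-cong : ∀ {τ τ′ x i} → τ i ≡ τ′ i → opens τ x i ≡ opens τ′ x i
opens-cong {x = x} eq = cong (λ t → if t ≡ᵇ suc x then 1 else 0) eq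

Counts-unopened : ∀ {N τ κ x s} → Counts N τ κ → κ x ≡ 0 → s < N → τ s ≢ suc x
Counts-unopened {N} {τ} {x = x} {s} counts κx≡0 s<N τs≡
  with () ← trans (sym (opens-≡ τ s τs≡)) (∑-zero⁻ N (trans (sym (counts x)) κx≡0) s<N)

-- The term at `s` falls from 1 to 0 for the head `x` and is 0 before and after for every other
-- head. The first component shows that the truncated predecessor is a genuine decrement.
Counts-close : ∀ {N τ κ s x} → Counts N τ κ → s < N → τ s ≡ suc x →
               κ x ≡ suc (pred (κ x)) ×
               Counts N (update s 0 τ) (update x (pred (κ x)) κ)
Counts-close {N} {τ} {κ} {s} {x} counts s<N τs≡ = κx≡suc , counts′
  where
  exchange : ∀ z → κ z + opens (update s 0 τ) z s ≡ ∑ N (opens (update s 0 τ) z) + opens τ z s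
  exchange z = trans (cong (_+ _) (counts z))
    (∑-replace N s<N λ i i≢s → opens-cong {τ} {update s 0 τ} {z} (sym (update-other τ i≢s)))

  closed : ∀ z → opens (update s 0 τ) z s ≡ 0
  closed z = opens-≢ (update s 0 τ) s λ eq → ℕ.0≢1+n (trans (sym (update-same τ s)) eq)

  κx≡ : κ x ≡ suc (∑ N (opens (update s 0 τ) x))
  κx≡ = trans (sym (ℕ.+-identityʳ (κ x))) (trans (cong (κ x +_) (sym (closed x)))
    (trans (exchange x) (trans (cong (∑ N (opens (update s 0 τ) x) +_) (opens-≡ τ s τs≡))
                               (ℕ.+-comm _ 1))))

  κx≡suc : κ x ≡ suc (pred (κ x))
  κx≡suc = trans κx≡ (cong (suc ∘ pred) (sym κx≡))

  counts′ : Counts N (update s 0 τ) (update x (pred (κ x)) κ)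
  counts′ z with z ℕ.≟ x
  ... | Dec.yes refl = trans (update-same κ x) (cong pred κx≡)
  ... | Dec.no z≢x = trans (update-other κ z≢x) (trans (sym (ℕ.+-identityʳ (κ z)))
    (trans (cong (κ z +_) (sym (closed z))) (trans (exchange z)
      (trans (cong (∑ N (opens (update s 0 τ) z) +_)
               (opens-≢ τ s λ eq → z≢x (sym (ℕ.suc-injective (trans (sym τs≡) eq)))))
             (ℕ.+-identityʳ _)))))

-- The new rule occupies position `p`. The rest of the added range still holds 0 and contributes
-- nothing.
Counts-open : ∀ {p p′ τ κ} x → p < p′ → (∀ {s} → p ≤ s → τ s ≡ 0) → Counts p τ κ →
              Counts p′ (update p (suc x) τ) (update x (suc (κ x)) κ)
Counts-open {p} {p′} {τ} {κ} x p<p′ unused counts z =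
  trans new (sym (trans (∑-extend beyond p<p′) (cong (opens τ′ z p +_) (∑-cong p old))))
  where
  τ′ = update p (suc x) τ

  beyond : ∀ i → suc p ≤ i → opens τ′ z i ≡ 0
  beyond i p<i = opens-≢ τ′ i λ eq → ℕ.0≢1+n
    (trans (sym (unused (ℕ.<⇒≤ p<i))) (trans (sym (update-other τ (ℕ.>⇒≢ p<i))) eq))

  old : ∀ i → i < p → opens τ′ z i ≡ opens τ z i
  old i i<p = opens-cong {τ′} {τ} {z} (update-other τ (ℕ.<⇒≢ i<p))

  new : update x (suc (κ x)) κ z ≡ opens τ′ z p + ∑ p (opens τ z)
  new with z ℕ.≟ x
  ... | Dec.yes refl = trans (update-same κ x)
    (cong₂ _+_ (sym (opens-≡ τ′ p (update-same τ p))) (counts x))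
  ... | Dec.no z≢x = trans (update-other κ z≢x)
    (cong₂ _+_ (sym (opens-≢ τ′ p λ eq →
                  z≢x (sym (ℕ.suc-injective (trans (sym (update-same τ p)) eq))))) (counts z))

Counts-extend : ∀ {p p′ τ κ} → p ≤ p′ → (∀ {s} → p ≤ s → τ s ≡ 0) → Counts p τ κ →
                Counts p′ τ κ
Counts-extend {τ = τ} p≤p′ unused counts x = trans (counts x) (sym (∑-extend
  (λ i p≤i → opens-≢ τ i λ eq → ℕ.0≢1+n (trans (sym (unused p≤i)) eq)) p≤p′))

-- A visit of x takes 5 steps and 13 for each of its nodes.
weight : List (ℕ × ℕ) → ℕ → ℕ
weight inc x = 5 + 13 * length (owners inc x)

∑-weight : ∀ n inc → ∑ n (weight inc) ≤ 5 * n + 13 * length inc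
∑-weight n inc = subst (_≤ 5 * n + 13 * length inc) (sym (expand n))
  (ℕ.+-monoʳ-≤ (5 * n) (ℕ.*-monoʳ-≤ 13 (∑-owners n inc)))
  where
  rearrange : ∀ m a b → 5 + 13 * a + (5 * m + 13 * b) ≡ 5 * suc m + 13 * (a + b)
  rearrange = solve-∀

  expand : ∀ m → ∑ m (weight inc) ≡ 5 * m + 13 * ∑ m (length ∘ owners inc)
  expand zero    = refl
  expand (suc m) = trans (cong (weight inc m +_) (expand m))
    (rearrange m (length (owners inc m)) (∑ m (length ∘ owners inc)))

-- The closure: invariant and potential.

module Closure (n N : ℕ) (τ₀ : ℕ → ℕ) (inc : List (ℕ × ℕ))
               (head<n : ∀ {s x} → τ₀ s ≡ suc x → x < n)
               (position<N : ∀ {s x} → τ₀ s ≡ suc x → s < N) where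

  -- Reachability, as seen from the open rules and the incidences in memory.
  data Settled (x : ℕ) : Set where
    settle : (∀ {s} → τ₀ s ≡ suc x → ∃[ y ] (y < n × Settled y × (y , s) ∈ˡ inc)) → Settled x

  -- The stack xs holds elements that are settled but not yet visited; ss are
  -- the rules still to be closed during the visit in progress.
  record Inv (τ κ : ℕ → ℕ) (xs ss : List ℕ) : Set where
    field
      counts  : Counts N τ κ
      orig    : ∀ {s x} → τ s ≡ suc x → τ₀ s ≡ suc x
      closed  : ∀ {s x} → τ₀ s ≡ suc x →
                τ s ≡ suc x ⊎ ∃[ y ] (y < n × Settled y × (y , s) ∈ˡ inc)
      visited : ∀ {y} → y < n → κ y ≡ 0 →
                y ∈ˡ xs ⊎ (∀ {s} → (y , s) ∈ˡ inc → τ s ≡ 0 ⊎ s ∈ˡ ss)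
      stacked : All (λ y → y < n × κ y ≡ 0) xs

  open Inv

  -- An originally open rule with head `x` is either still open, and would then be counted, or was
  -- closed, and `closed` then provides its support.
  zero⇒settled : ∀ {τ κ xs ss x} → Inv τ κ xs ss → κ x ≡ 0 → Settled x
  zero⇒settled {τ} inv κx≡0 = settle λ τ₀s≡ → open-or-supported τ₀s≡ (closed inv τ₀s≡)
    where
    open-or-supported : ∀ {s} → τ₀ s ≡ suc _ → τ s ≡ suc _ ⊎ _ → _
    open-or-supported τ₀s≡ (inj₁ τs≡) =
      contradiction τs≡ (Counts-unopened {τ = τ} (counts inv) κx≡0 (position<N τ₀s≡))
    open-or-supported τ₀s≡ (inj₂ supported) = supported

  -- Induction on `Settled`. A rule with head `x` has a settled element in its body, whose counter
  -- is 0 by induction. With nothing stacked or pending, that element has been visited and the rule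
  -- is closed, so no open rule remains to be counted.
  settled⇒zero : ∀ {τ κ} → Inv τ κ [] [] → ∀ {x} → Settled x → κ x ≡ 0
  settled⇒zero {τ} inv {x} (settle support) = trans (counts inv x)
    (∑-zero N λ s _ → opens-≢ τ s λ τs≡ → no-open s τs≡)
    where
    no-open : ∀ s → τ s ≢ suc x
    no-open s τs≡ with support (orig inv τs≡)
    ... | y , y<n , settled , ys∈ with visited inv y<n (settled⇒zero inv settled)
    ... | inj₂ done with done ys∈
    ... | inj₁ τs≡0 = ℕ.0≢1+n (trans (sym τs≡0) τs≡)

  Inv-start : ∀ {κ xs} → Counts N τ₀ κ → (∀ {y} → y < n → κ y ≡ 0 → y ∈ˡ xs) →
              All (λ y → y < n × κ y ≡ 0) xs → Inv τ₀ κ xs []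
  Inv-start counts₀ complete sound = record
    { counts = counts₀ ; orig = id ; closed = inj₁
    ; visited = λ y<n κy≡0 → inj₁ (complete y<n κy≡0) ; stacked = sound }

  -- The popped element is no longer accounted for by the stack, so the rules at its nodes become
  -- the pending ones.
  Inv-pop : ∀ {τ κ y xs} → Inv τ κ (y ∷ xs) [] → Inv τ κ xs (owners inc y)
  Inv-pop {τ} {κ} {y} {xs} inv = record
    { counts = counts inv ; orig = orig inv ; closed = closed inv
    ; visited = λ z<n κz≡0 → popped (visited inv z<n κz≡0) ; stacked = All.tail (stacked inv) }
    where
    popped : ∀ {z} → z ∈ˡ (y ∷ xs) ⊎ (∀ {s} → (z , s) ∈ˡ inc → τ s ≡ 0 ⊎ s ∈ˡ []) →
             z ∈ˡ xs ⊎ (∀ {s} → (z , s) ∈ˡ inc → τ s ≡ 0 ⊎ s ∈ˡ owners inc y)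
    popped (inj₁ (here refl)) = inj₂ λ zs∈ → inj₂ (∈-owners⁺ zs∈)
    popped (inj₁ (there z∈))  = inj₁ z∈
    popped (inj₂ done)        = inj₂ λ zs∈ → inj₁ (Sum.[ id , (λ ()) ] (done zs∈))

  Inv-skip : ∀ {τ κ xs s ss} → Inv τ κ xs (s ∷ ss) → τ s ≡ 0 → Inv τ κ xs ss
  Inv-skip {τ} {s = s} {ss} inv τs≡0 = record
    { counts = counts inv ; orig = orig inv ; closed = closed inv
    ; visited = λ y<n κy≡0 → Sum.map₂ (λ done {_} ys∈ → skipped (done ys∈)) (visited inv y<n κy≡0)
    ; stacked = stacked inv }
    where
    skipped : ∀ {r} → τ r ≡ 0 ⊎ r ∈ˡ (s ∷ ss) → τ r ≡ 0 ⊎ r ∈ˡ ss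
    skipped (inj₁ τr≡0)         = inj₁ τr≡0
    skipped (inj₂ (here refl))  = inj₁ τs≡0
    skipped (inj₂ (there r∈ss)) = inj₂ r∈ss

  module _ {τ κ xs s ss q y} (inv : Inv τ κ xs (s ∷ ss)) (τs≡ : τ s ≡ suc q)
           (y<n : y < n) (settled : Settled y) (ys∈ : (y , s) ∈ˡ inc) where

    private
      τ′ = update s 0 τ
      κ′ = update q (pred (κ q)) κ

    q<n : q < n
    q<n = head<n (orig inv τs≡)

    closing : κ q ≡ suc (pred (κ q)) × Counts N τ′ κ′
    closing = Counts-close {τ = τ} (counts inv) (position<N (orig inv τs≡)) τs≡

    -- Covers both outcomes of the test after the decrement: `xs′` is `q ∷ xs` if the counter has
    -- reached 0 and `xs` otherwise.
    Inv-close : ∀ {xs′} → (∀ {z} → z ∈ˡ xs → z ∈ˡ xs′) → (κ′ q ≡ 0 → q ∈ˡ xs′) →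
                All (λ z → z < n × κ′ z ≡ 0) xs′ → Inv τ′ κ′ xs′ ss
    Inv-close {xs′} xs⊆ pushed stacked′ = record
      { counts = proj₂ closing
      ; orig = λ {r} τ′r≡ → orig inv (trans (sym (unchanged r τ′r≡)) τ′r≡)
      ; closed = λ {r} τ₀r≡ → closed′ r τ₀r≡
      ; visited = visited′
      ; stacked = stacked′ }
      where
      unchanged : ∀ r {x} → τ′ r ≡ suc x → τ′ r ≡ τ r
      unchanged r τ′r≡ with r ℕ.≟ s
      ... | Dec.yes refl = contradiction (trans (sym (update-same τ s)) τ′r≡) ℕ.0≢1+n
      ... | Dec.no r≢s   = update-other τ r≢s

      closed′ : ∀ r {x} → τ₀ r ≡ suc x →
                τ′ r ≡ suc x ⊎ ∃[ z ] (z < n × Settled z × (z , r) ∈ˡ inc)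
      closed′ r τ₀r≡ with r ℕ.≟ s
      ... | Dec.yes refl = inj₂ (y , y<n , settled , ys∈)
      ... | Dec.no r≢s   = Sum.map₁ (trans (update-other τ r≢s)) (closed inv τ₀r≡)

      done′ : ∀ {r} → τ r ≡ 0 ⊎ r ∈ˡ (s ∷ ss) → τ′ r ≡ 0 ⊎ r ∈ˡ ss
      done′ (inj₂ (here refl)) = inj₁ (update-same τ s)
      done′ (inj₂ (there r∈))  = inj₂ r∈
      done′ {r} (inj₁ τr≡0) with r ℕ.≟ s
      ... | Dec.yes refl = inj₁ (update-same τ s)
      ... | Dec.no r≢s   = inj₁ (trans (update-other τ r≢s) τr≡0)

      visited′ : ∀ {z} → z < n → κ′ z ≡ 0 →
                 z ∈ˡ xs′ ⊎ (∀ {r} → (z , r) ∈ˡ inc → τ′ r ≡ 0 ⊎ r ∈ˡ ss)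
      visited′ {z} z<n κ′z≡0 with z ℕ.≟ q
      ... | Dec.yes refl = inj₁ (pushed κ′z≡0)
      ... | Dec.no z≢q with visited inv z<n (trans (sym (update-other κ z≢q)) κ′z≡0)
      ...   | inj₁ z∈xs = inj₁ (xs⊆ z∈xs)
      ...   | inj₂ done = inj₂ λ zr∈ → done′ (done zr∈)

    -- Stacked elements have counter 0, whereas the counter of `q` was positive. Hence `q` is not
    -- among them and the decrement leaves their counters alone.
    stacked′ : All (λ z → z < n × κ′ z ≡ 0) xs
    stacked′ = All.map still (stacked inv)
      where
      still : ∀ {z} → z < n × κ z ≡ 0 → z < n × κ′ z ≡ 0
      still {z} (z<n , κz≡0) with z ℕ.≟ q
      ... | Dec.yes refl = contradiction (trans (sym κz≡0) (proj₁ closing)) ℕ.0≢1+n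
      ... | Dec.no z≢q   = z<n , trans (update-other κ z≢q) κz≡0

  unpaid : (ℕ → ℕ) → ℕ → ℕ
  unpaid κ x = if κ x ≡ᵇ 0 then 0 else weight inc x

  -- Bounds the running time of the closure: every element pays its weight
  -- when it is popped, and is pushed only when its counter reaches 0.
  potential : (ℕ → ℕ) → List ℕ → ℕ
  potential κ xs = ∑ n (unpaid κ) + sum (map (weight inc) xs)

  unpaid-0 : ∀ κ {x} → κ x ≡ 0 → unpaid κ x ≡ 0
  unpaid-0 κ eq rewrite eq = refl

  unpaid-suc : ∀ κ {x c} → κ x ≡ suc c → unpaid κ x ≡ weight inc x
  unpaid-suc κ eq rewrite eq = refl

  unpaid-cong : ∀ κ κ′ {x} → κ x ≡ κ′ x → unpaid κ x ≡ unpaid κ′ x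
  unpaid-cong κ κ′ eq rewrite eq = refl

  module _ {κ : ℕ → ℕ} {q c c′ : ℕ} (κq≡ : κ q ≡ suc c) where

    -- The weight of `q` moves from the unpaid summand to the stack summand.
    potential-push : ∀ {xs} → q < n → c′ ≡ 0 →
                     potential (update q c′ κ) (q ∷ xs) ≡ potential κ xs
    potential-push {xs} q<n refl = trans (sym (ℕ.+-assoc (∑ n (unpaid κ′)) _ _))
      (cong (_+ sum (map (weight inc) xs)) (begin
        ∑ n (unpaid κ′) + weight inc q ≡⟨ cong (∑ n (unpaid κ′) +_) (unpaid-suc κ κq≡) ⟨
        ∑ n (unpaid κ′) + unpaid κ q   ≡⟨ ∑-replace n q<n (λ i i≢q →
                                            unpaid-cong κ κ′ (sym (update-other κ i≢q))) ⟨
        ∑ n (unpaid κ) + unpaid κ′ q   ≡⟨ cong (∑ n (unpaid κ) +_) (unpaid-0 κ′ (update-same κ q)) ⟩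
        ∑ n (unpaid κ) + 0             ≡⟨ ℕ.+-identityʳ _ ⟩
        ∑ n (unpaid κ)                 ∎))
      where
      open ≡-Reasoning
      κ′ = update q c′ κ

    potential-keep : ∀ {xs d} → c′ ≡ suc d → potential (update q c′ κ) xs ≡ potential κ xs
    potential-keep {xs} refl = cong (_+ sum (map (weight inc) xs)) (∑-cong n λ i _ → same i)
      where
      κ′ = update q c′ κ
      same : ∀ i → unpaid κ′ i ≡ unpaid κ i
      same i with i ℕ.≟ q
      ... | Dec.yes refl = trans (unpaid-suc κ′ (update-same κ q)) (sym (unpaid-suc κ κq≡))
      ... | Dec.no i≢q   = unpaid-cong κ′ κ (update-other κ i≢q)

-- Visiting elements

positive : ∀ {s} x {k} → reg s ground ≡ 0 → reg s x ≡ suc k → holds (ground << x) s ≡ true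
positive x z e = cong₂ _<ᵇ_ z e

not-positive : ∀ {s} x → reg s ground ≡ 0 → reg s x ≡ 0 → holds (ground << x) s ≡ false
not-positive x z e = cong₂ _<ᵇ_ z e

is-zero : ∀ {s} x → reg s ground ≡ 0 → reg s x ≡ 0 → holds (x == ground) s ≡ true
is-zero x z e = cong₂ _≡ᵇ_ e z

not-zero : ∀ {s} x {k} → reg s ground ≡ 0 → reg s x ≡ suc k → holds (x == ground) s ≡ false
not-zero x z e = cong₂ _≡ᵇ_ e z

Stack-empty : ∀ {σ k} → Stack σ k [] → k ≡ 0
Stack-empty [] = refl

Stack-pop : ∀ {σ k x xs} → Stack σ k (x ∷ xs) →
            k ≡ suc (pred k) × σ (pred k) ≡ x × Stack σ (pred k) xs
Stack-pop (top≡ ∷ rest) = refl , top≡ , rest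

module Closing (n N : ℕ) (τ₀ : ℕ → ℕ) (inc : List (ℕ × ℕ))
               (head<n : ∀ {s x} → τ₀ s ≡ suc x → x < n)
               (position<N : ∀ {s x} → τ₀ s ≡ suc x → s < N) where

  open Closure n N τ₀ inc head<n position<N

  -- `Φ` stays fixed during a whole visit: the visited element has paid on being popped, and a push
  -- only moves weight inside the potential.
  record Closes (Φ : ℕ) (ss : List ℕ) (s : State) : Set where
    constructor closes
    field
      {pushed} : List ℕ
      inv      : Inv (arr s open-rule) (arr s count) pushed ss
      stacked  : Stack (arr s stack) (reg s top) pushed
      budget   : potential (arr s count) pushed ≡ Φ

  settleRule-run : ∀ {s Φ y ss} → let r = reg s origin in reg s ground ≡ 0 →
    arr s open-rule r ≡ suc (pred (reg s temp)) →
    y < n → Settled y → (y , r) ∈ˡ inc → Closes Φ (r ∷ ss) s →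
    Run settleRule s 8 (Closes Φ ss)
  settleRule-run {s} {Φ} {y} {ss} z τr≡ y<n settled yr∈ (closes {xs} inv stacked budget) =
    ▸ ▸ ▸ ▸ ▸ finish (pred (κ q)) refl
    where
    q = pred (reg s temp)
    κ = arr s count
    κq≡ = proj₁ (closing inv τr≡ y<n settled yr∈)
    κ′ = update q (pred (κ q)) κ
    s₅ = perform (count [ target ]≔ temp) (perform (temp ≔pred temp)
           (perform (temp ≔ count [ target ])
           (perform (open-rule [ origin ]≔ ground) (perform (target ≔pred temp) s))))

    -- The program writes the content of `ground`, the invariant speaks of a literal 0.
    grounded : ∀ {xs′} → Inv (update (reg s origin) 0 (arr s open-rule)) κ′ xs′ ss →
               Inv (update (reg s origin) (reg s ground) (arr s open-rule)) κ′ xs′ ss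
    grounded = subst (λ v → Inv (update (reg s origin) v (arr s open-rule)) κ′ _ ss) (sym z)

    kept = stacked′ inv τr≡ y<n settled yr∈

    finish : ∀ c → pred (κ q) ≡ c → Run (cond (temp == ground) push skip) s₅ 3 (Closes Φ ss)
    finish zero eq = then-run (is-zero {s₅} temp z eq) (▸ stop (closes
      (grounded (Inv-close inv τr≡ y<n settled yr∈ there (λ _ → here refl)
        ((q<n inv τr≡ y<n settled yr∈ , trans (update-same κ q) eq) ∷ kept)))
      (Stack-push q stacked)
      (trans (potential-push κq≡ {xs} (q<n inv τr≡ y<n settled yr∈) eq) budget)))
    finish (suc c) eq = within (s≤s z≤n) (else-run (not-zero {s₅} temp z eq) (halt (closes
      (grounded (Inv-close inv τr≡ y<n settled yr∈ id
        (λ κ′q≡0 → contradiction (trans (sym κ′q≡0) (trans (update-same κ q) eq)) ℕ.0≢1+n)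
        kept))
      stacked
      (trans (potential-keep κq≡ {xs} eq) budget))))

  visitNode-run : ∀ {s Φ y ss} → let r = arr s owner (reg s node) in reg s ground ≡ 0 →
    y < n → Settled y → (y , r) ∈ˡ inc → Closes Φ (r ∷ ss) s →
    Run visitNode s 12 (λ s′ → Closes Φ ss s′ × reg s′ node ≡ arr s next (reg s node))
  visitNode-run {s} {Φ} {y} {ss} z y<n settled yr∈ c = ▸ ▸
    (split (arr s open-rule (arr s owner (reg s node))) refl ▹
     λ { trace (closes inv stacked budget) → stop
           (closes inv stacked budget ,
            cong₂ (λ f k → f k) (arr-frame next trace refl) (reg-frame node trace refl)) })
    where
    s₂ = perform (temp ≔ open-rule [ origin ]) (perform (origin ≔ owner [ node ]) s)

    split : ∀ t → reg s₂ temp ≡ t → Run (cond (ground << temp) settleRule skip) s₂ 9 (Closes Φ ss)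
    split zero eq = within (s≤s z≤n) (else-run (not-positive {s₂} temp z eq)
      (halt (closes (Inv-skip (Closes.inv c) eq) (Closes.stacked c) (Closes.budget c))))
    split (suc q) eq = then-run (positive {s₂} temp z eq)
      (settleRule-run z (trans eq (cong (suc ∘ pred) (sym eq))) y<n settled yr∈
        (closes (Closes.inv c) (Closes.stacked c) (Closes.budget c)))

  visitNodes-run : ∀ {s Φ y k ss} → reg s ground ≡ 0 → reg s node ≡ k →
    Chain (arr s next) (arr s owner) k ss → y < n → Settled y →
    (∀ {r} → r ∈ˡ ss → (y , r) ∈ˡ inc) → Closes Φ ss s →
    Run (while (ground << node) visitNode) s (1 + 13 * length ss) (Closes Φ [])
  visitNodes-run {s} z at [] y<n settled ys c = loop-end (not-positive {s} node z at) c
  visitNodes-run {s} {ss = _ ∷ ss} z refl (link refl refl k′<k chain) y<n settled ys c =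
    within (ℕ.≤-reflexive (charge (length ss))) (loop-step
      (positive {s} node z (sym (ℕ.suc-pred (reg s node) ⦃ >-nonZero (ℕ.≤-<-trans z≤n k′<k) ⦄)))
      (visitNode-run z y<n settled (ys (here refl)) c)
      λ { trace (c′ , moved) → visitNodes-run (trans (reg-frame ground trace refl) z) moved
        (subst₂ (λ ν ω → Chain ν ω _ ss) (sym (arr-frame next trace refl))
          (sym (arr-frame owner trace refl)) chain)
        y<n settled (ys ∘ there) c′ })
    where
    charge : ∀ m → suc (12 + (1 + 13 * m)) ≡ 1 + 13 * suc m
    charge = solve-∀

  -- A visit may push further elements, so the stack is no measure for the recursion. The potential
  -- is one: popping `y` lowers it by the weight of `y`, at least 5, and `fuel` bounds it.
  visitElements-run : ∀ fuel {s xs} → potential (arr s count) xs ≤ fuel → reg s ground ≡ 0 →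
    (∀ z → Chain (arr s next) (arr s owner) (arr s head z) (owners inc z)) →
    Inv (arr s open-rule) (arr s count) xs [] → Stack (arr s stack) (reg s top) xs →
    Run (while (ground << top) visitElement) s (1 + potential (arr s count) xs)
        (λ s′ → Inv (arr s′ open-rule) (arr s′ count) [] [])
  visitElements-run fuel {s} {[]} enough z chains inv stacked =
    within (s≤s z≤n) (loop-end (not-positive {s} top z (Stack-empty stacked)) inv)
  visitElements-run fuel {s} {y ∷ xs} enough z chains inv stacked
    with nonempty , refl , rest ← Stack-pop stacked
    with fuel
  ... | zero = contradiction (ℕ.≤-trans (ℕ.m≤n+m _ (∑ n (unpaid (arr s count)))) enough) λ ()
  ... | suc fuel = within (ℕ.≤-reflexive (charge P W S))
    (loop-step (positive {s} top z nonempty)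
      (▸ ▸ ▸ visitNodes-run z refl (chains y) y<n (zero⇒settled inv κy≡0) (∈-owners⁻ inc)
        (closes (Inv-pop inv) rest refl))
      λ { trace (closes inv′ stacked′ budget) →
        within (ℕ.≤-reflexive (cong suc budget))
          (visitElements-run fuel
            (subst (_≤ fuel) (sym budget) (ℕ.≤-trans (ℕ.m≤n+m (P + S) (4 + 13 * W))
              (ℕ.≤-pred (subst (_≤ suc fuel) (charge′ P W S) enough))))
            (trans (reg-frame ground trace refl) z)
            (λ x → subst₂ (λ ν ω → Chain ν ω _ (owners inc x))
              (sym (arr-frame next trace refl)) (sym (arr-frame owner trace refl))
              (subst (λ η → Chain _ _ (η x) (owners inc x)) (sym (arr-frame head trace refl))
                (chains x)))
            inv′ stacked′) })
    where
    P = ∑ n (unpaid (arr s count))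
    W = length (owners inc y)
    S = sum (map (weight inc) xs)
    y<n  = proj₁ (All.head (Inv.stacked inv))
    κy≡0 = proj₂ (All.head (Inv.stacked inv))

    -- The constant 5 of the weight is made up of the outer test, three instructions and the last
    -- test of the inner loop.
    charge : ∀ P W S → suc (3 + (1 + 13 * W) + (1 + (P + S))) ≡ 1 + (P + (5 + 13 * W + S))
    charge = solve-∀

    charge′ : ∀ P W S → P + (5 + 13 * W + S) ≡ suc (4 + 13 * W + (P + S))
    charge′ = solve-∀

-- Seeding the stack.

<⇒<ᵇ-true : ∀ {m n} → m < n → (m <ᵇ n) ≡ true
<⇒<ᵇ-true {zero}  (s≤s _)   = refl
<⇒<ᵇ-true {suc m} (s≤s m<n) = <⇒<ᵇ-true m<n

<ᵇ-irrefl : ∀ m → (m <ᵇ m) ≡ false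
<ᵇ-irrefl zero    = refl
<ᵇ-irrefl (suc m) = <ᵇ-irrefl m

module Seeding (n N : ℕ) (τ₀ : ℕ → ℕ) (inc : List (ℕ × ℕ))
               (head<n : ∀ {s x} → τ₀ s ≡ suc x → x < n)
               (position<N : ∀ {s x} → τ₀ s ≡ suc x → s < N) where

  open Closure n N τ₀ inc head<n position<N

  -- By `balance`, the initial potential is the total weight of all elements, whichever counters are
  -- 0 at the start.
  record Zeros (i : ℕ) (κ : ℕ → ℕ) (xs : List ℕ) : Set where
    field
      sound    : All (λ y → y < i × κ y ≡ 0) xs
      complete : ∀ {y} → y < i → κ y ≡ 0 → y ∈ˡ xs
      balance  : ∑ i (unpaid κ) + sum (map (weight inc) xs) ≡ ∑ i (weight inc)

  open Zeros

  Zeros-push : ∀ {i κ xs} → κ i ≡ 0 → Zeros i κ xs → Zeros (suc i) κ (i ∷ xs)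
  Zeros-push {i} {κ} {xs} κi≡0 zeros = record
    { sound = (ℕ.≤-refl , κi≡0) ∷ All.map (λ (y<i , κy≡0) → ℕ.m<n⇒m<1+n y<i , κy≡0) (sound zeros)
    ; complete = λ y<1+i κy≡0 → complete′ κy≡0 (ℕ.m<1+n⇒m<n∨m≡n y<1+i)
    ; balance = trans (cong (λ u → u + ∑ i (unpaid κ) + _) (unpaid-0 κ κi≡0))
        (trans (swap (∑ i (unpaid κ)) (weight inc i) _) (cong (weight inc i +_) (balance zeros))) }
    where
    complete′ : ∀ {y} → κ y ≡ 0 → y < i ⊎ y ≡ i → y ∈ˡ (i ∷ xs)
    complete′ κy≡0 (inj₁ y<i)  = there (complete zeros y<i κy≡0)
    complete′ _    (inj₂ refl) = here refl

    swap : ∀ a w b → a + (w + b) ≡ w + (a + b)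
    swap = solve-∀

  Zeros-skip : ∀ {i κ xs c} → κ i ≡ suc c → Zeros i κ xs → Zeros (suc i) κ xs
  Zeros-skip {i} {κ} {xs} κi≡ zeros = record
    { sound = All.map (λ (y<i , κy≡0) → ℕ.m<n⇒m<1+n y<i , κy≡0) (sound zeros)
    ; complete = λ y<1+i κy≡0 → complete′ κy≡0 (ℕ.m<1+n⇒m<n∨m≡n y<1+i)
    ; balance = trans (cong (λ u → u + ∑ i (unpaid κ) + _) (unpaid-suc κ κi≡))
        (trans (ℕ.+-assoc (weight inc i) _ _) (cong (weight inc i +_) (balance zeros))) }
    where
    complete′ : ∀ {y} → κ y ≡ 0 → y < i ⊎ y ≡ i → y ∈ˡ xs
    complete′ κy≡0 (inj₁ y<i)  = complete zeros y<i κy≡0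
    complete′ κy≡0 (inj₂ refl) = contradiction (trans (sym κy≡0) κi≡) ℕ.0≢1+n

  Seeded : ℕ → State → Set
  Seeded i s = ∃[ xs ] (Zeros i (arr s count) xs × Stack (arr s stack) (reg s top) xs)

  pushZero-run : ∀ {s} → reg s ground ≡ 0 → Seeded (reg s target) s →
                 Run pushZero s 5 (λ s′ → Seeded (reg s′ target) s′ ×
                                          reg s′ target ≡ suc (reg s target))
  pushZero-run {s} z (xs , zeros , stacked) = ▸ (go (arr s count (reg s target)) refl ▹
    λ { trace seeded → stop (seeded , cong suc (reg-frame target trace refl)) })
    where
    s₁ = perform (temp ≔ count [ target ]) s

    go : ∀ c → arr s count (reg s target) ≡ c →
         Run (cond (temp == ground) push skip) s₁ 3 (λ s′ → Seeded (suc (reg s′ target)) s′)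
    go zero eq = then-run (is-zero {s₁} temp z eq)
      (▸ stop (_ , Zeros-push eq zeros , Stack-push (reg s target) stacked))
    go (suc c) eq = within (s≤s z≤n) (else-run (not-zero {s₁} temp z eq)
      (halt (xs , Zeros-skip eq zeros , stacked)))

  pushZeros-run : ∀ d {s} → d + reg s target ≡ reg s size-n → reg s ground ≡ 0 →
                  Seeded (reg s target) s →
                  Run (while (target << size-n) pushZero) s (1 + 6 * d) (Seeded (reg s size-n))
  pushZeros-run zero {s} eq z seeded = loop-end
    (trans (cong (reg s target <ᵇ_) (sym eq)) (<ᵇ-irrefl (reg s target)))
    (subst (λ i → Seeded i s) eq seeded)
  pushZeros-run (suc d) {s} eq z seeded = within (ℕ.≤-reflexive (charge d)) (loop-step
    (<⇒<ᵇ-true (subst (reg s target <_) eq (s≤s (ℕ.m≤n+m (reg s target) d))))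
    (pushZero-run z seeded)
    λ { trace (seeded′ , advanced) →
      let size-fixed = reg-frame size-n trace refl in
      refine (pushZeros-run d
        (trans (cong (d +_) advanced) (trans (ℕ.+-suc d _) (trans eq (sym size-fixed))))
        (trans (reg-frame ground trace refl) z) seeded′)
        λ {_} {s″} _ → subst (λ i → Seeded i s″) size-fixed })
    where
    charge : ∀ d → suc (5 + (1 + 6 * d)) ≡ 1 + 6 * suc d
    charge = solve-∀

-- Reading the input

-- Both directions of ownership matter: `owned⁻` serves to turn settled elements into reachable
-- ones, `owned⁺` serves the converse.
record Represents {n} (τ : ℕ → ℕ) (inc : List (ℕ × ℕ)) (s : ℕ) (r : Rule n) : Set where
  field
    opened : τ s ≡ suc (toℕ (proj₂ r))
    owned⁺ : ∀ {y} → y ∈ proj₁ r → (toℕ y , s) ∈ˡ inc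
    owned⁻ : ∀ {z} → (z , s) ∈ˡ inc → ∃[ y ] (y ∈ proj₁ r × z ≡ toℕ y)

-- The memory after the rules in P have been read from the first p positions.
record Built {n} (P : Rule n → Set) (p : ℕ) (inc : List (ℕ × ℕ)) (τ κ : ℕ → ℕ) : Set where
  field
    counts   : Counts p τ κ
    unused   : ∀ {s} → p ≤ s → τ s ≡ 0
    bounded  : ∀ {z s} → (z , s) ∈ˡ inc → s < p
    sound    : ∀ {s x} → τ s ≡ suc x → ∃[ r ] (P r × proj₂ r ∉ proj₁ r × Represents τ inc s r)
    complete : ∀ {r} → P r → proj₂ r ∉ proj₁ r → ∃[ s ] Represents τ inc s r

Built-⇔ : ∀ {n} {P P′ : Rule n → Set} {p inc τ κ} → (∀ r → P r ⇔ P′ r) →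
          Built P p inc τ κ → Built P′ p inc τ κ
Built-⇔ P⇔P′ built = record
  { counts = counts ; unused = unused ; bounded = bounded
  ; sound = λ τs≡ → let r , Pr , rest = sound τs≡ in r , to (P⇔P′ r) Pr , rest
  ; complete = λ {r} P′r → complete (from (P⇔P′ r) P′r) }
  where open Built built

position<end : ∀ {n} {P : Rule n → Set} {p inc τ κ s x} → Built P p inc τ κ → τ s ≡ suc x → s < p
position<end built τs≡ = ℕ.≰⇒> λ p≤s →
  ℕ.0≢1+n (trans (sym (Built.unused built p≤s)) τs≡)

module _ {n} {P : Rule n → Set} {p p′ inc τ κ} (built : Built P p inc τ κ) (p<p′ : p < p′)
         {B : Subset n} {q : Fin n} (ys : List (Fin n)) (ys⇔B : ∀ y → y ∈ˡ ys ⇔ y ∈ B) where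
  open Built built

  P⁺ : Rule n → Set
  P⁺ r = r ≡ (B , q) ⊎ P r

  inc⁺ : List (ℕ × ℕ)
  inc⁺ = map (λ y → toℕ y , p) ys ++ inc

  inc⁺-split : ∀ {z s} → (z , s) ∈ˡ inc⁺ → (s ≡ p × ∃[ y ] (y ∈ B × z ≡ toℕ y)) ⊎ (z , s) ∈ˡ inc
  inc⁺-split zs∈ with ∈-++⁻ (map (λ y → toℕ y , p) ys) zs∈
  ... | inj₂ old = inj₂ old
  ... | inj₁ new with y , y∈ , refl ← ∈-map⁻ (λ y → toℕ y , p) new =
    inj₁ (refl , y , to (ys⇔B y) y∈ , refl)

  bounded⁺ : ∀ {z s} → (z , s) ∈ˡ inc⁺ → s < p′
  bounded⁺ zs∈ with inc⁺-split zs∈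
  ... | inj₁ (refl , _) = p<p′
  ... | inj₂ old        = ℕ.<-trans (bounded old) p<p′

  Represents⁺ : ∀ {τ′ s} {r : Rule n} → τ′ s ≡ τ s → s ≢ p → Represents τ inc s r →
                Represents τ′ inc⁺ s r
  Represents⁺ {s = s} {r} same s≢p rep = record
    { opened = trans same opened ; owned⁺ = λ y∈ → ∈-++⁺ʳ _ (owned⁺ y∈)
    ; owned⁻ = λ zs∈ → owned (inc⁺-split zs∈) }
    where
    open Represents rep
    owned : ∀ {z} → (s ≡ p × ∃[ y ] (y ∈ B × z ≡ toℕ y)) ⊎ (z , s) ∈ˡ inc →
            ∃[ y ] (y ∈ proj₁ r × z ≡ toℕ y)
    owned (inj₁ (s≡p , _)) = contradiction s≡p s≢p
    owned (inj₂ old)       = owned⁻ old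

  -- The nodes are linked before the end of the body decides the flag. They point to `p`, where `τ`
  -- remains 0, and a visit passes over them.
  Built-satisfied : q ∈ B → Built P⁺ p′ inc⁺ τ κ
  Built-satisfied q∈B = record
    { counts = Counts-extend {τ = τ} (ℕ.<⇒≤ p<p′) unused counts
    ; unused = λ p′≤s → unused (ℕ.≤-trans (ℕ.<⇒≤ p<p′) p′≤s)
    ; bounded = bounded⁺
    ; sound = λ τs≡ → let r , Pr , q∉ , rep = sound τs≡ in
        r , inj₂ Pr , q∉ , Represents⁺ refl (ℕ.<⇒≢ (position<end built τs≡)) rep
    ; complete = complete⁺ }
    where
    complete⁺ : ∀ {r} → P⁺ r → proj₂ r ∉ proj₁ r → ∃[ s ] Represents τ inc⁺ s r
    complete⁺ (inj₁ refl) q∉B = contradiction q∈B q∉B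
    complete⁺ (inj₂ Pr) q∉ with s , rep ← complete Pr q∉ =
      s , Represents⁺ refl (ℕ.<⇒≢ (position<end built (Represents.opened rep))) rep

  -- Earlier incidences belong to positions below `p`, so those at `p` are exactly the ones of the
  -- new rule.
  Built-open : ∀ {o x} → o ≡ p → x ≡ toℕ q → q ∉ B →
               Built P⁺ p′ inc⁺ (update o (suc x) τ) (update x (suc (κ x)) κ)
  Built-open refl refl q∉B = record
    { counts = Counts-open {τ = τ} (toℕ q) p<p′ unused counts
    ; unused = λ p′≤s → let p<s = ℕ.<-≤-trans p<p′ p′≤s in
        trans (update-other τ (ℕ.>⇒≢ p<s)) (unused (ℕ.<⇒≤ p<s))
    ; bounded = bounded⁺ ; sound = sound⁺ ; complete = complete⁺ }
    where
    τ⁺ = update p (suc (toℕ q)) τ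

    new : Represents τ⁺ inc⁺ p (B , q)
    new = record
      { opened = update-same τ p
      ; owned⁺ = λ {y} y∈B → ∈-++⁺ˡ (∈-map⁺ (λ y → toℕ y , p) (from (ys⇔B y) y∈B))
      ; owned⁻ = λ zp∈ → owned (inc⁺-split zp∈) }
      where
      owned : ∀ {z} → (p ≡ p × ∃[ y ] (y ∈ B × z ≡ toℕ y)) ⊎ (z , p) ∈ˡ inc →
              ∃[ y ] (y ∈ B × z ≡ toℕ y)
      owned (inj₁ (_ , here-in-B)) = here-in-B
      owned (inj₂ old)             = contradiction (bounded old) (ℕ.<-irrefl refl)

    old : ∀ {s r} → Represents τ inc s r → Represents τ⁺ inc⁺ s r
    old {s} rep = Represents⁺ (update-other τ s≢p) s≢p rep
      where s≢p = ℕ.<⇒≢ (position<end built (Represents.opened rep))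

    sound⁺ : ∀ {s x} → τ⁺ s ≡ suc x →
             ∃[ r ] (P⁺ r × proj₂ r ∉ proj₁ r × Represents τ⁺ inc⁺ s r)
    sound⁺ {s} τ⁺s≡ with s ℕ.≟ p
    ... | Dec.yes refl = _ , inj₁ refl , q∉B , new
    ... | Dec.no s≢p with r , Pr , q∉ , rep ← sound (trans (sym (update-other τ s≢p)) τ⁺s≡) =
      r , inj₂ Pr , q∉ , old rep

    complete⁺ : ∀ {r} → P⁺ r → proj₂ r ∉ proj₁ r → ∃[ s ] Represents τ⁺ inc⁺ s r
    complete⁺ (inj₁ refl) _ = p , new
    complete⁺ (inj₂ Pr) q∉ with s , rep ← complete Pr q∉ = s , old rep

module _ {n} {P : Rule n → Set} {p inc τ κ} (built : Built P p inc τ κ) where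
  open Built built

  head<size : ∀ {s x} → τ s ≡ suc x → x < n
  head<size τs≡ with (_ , q) , _ , _ , rep ← sound τs≡ =
    subst (_< n) (ℕ.suc-injective (trans (sym (Represents.opened rep)) τs≡)) (Fin.toℕ<n q)

  open Closure n p τ inc head<size (position<end built)

  -- Rules containing their head have no open position but are met by the disjunct `x ∈ B`. All
  -- others have one by `complete`.
  settled⇒reachable : ∀ {x} → Settled (toℕ x) → Reachable P x
  settled⇒reachable {x} (settle support) = reach supported
    where
    supported : ∀ {B} → P (B , x) → x ∈ B ⊎ ∃[ y ] (y ∈ B × Reachable P y)
    supported {B} Pr with x Sub.∈? B
    ... | Dec.yes x∈B = inj₁ x∈B
    ... | Dec.no x∉B with s , rep ← complete Pr x∉B
      with _ , _ , settled , ys∈ ← support (Represents.opened rep)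
      with y , y∈B , refl ← Represents.owned⁻ rep ys∈ =
      inj₂ (y , y∈B , settled⇒reachable settled)

  reachable⇒settled : ∀ {x} → Reachable P x → Settled (toℕ x)
  reachable⇒settled {x} (reach support) = settle supported
    where
    supported : ∀ {s} → τ s ≡ suc (toℕ x) → ∃[ y ] (y < n × Settled y × (y , s) ∈ˡ inc)
    supported τs≡ with (B , q) , Pr , q∉B , rep ← sound τs≡
      with refl ← Fin.toℕ-injective (ℕ.suc-injective (trans (sym τs≡) (Represents.opened rep)))
      with support Pr
    ... | inj₁ x∈B = contradiction x∈B q∉B
    ... | inj₂ (y , y∈B , reachable) =
      toℕ y , Fin.toℕ<n y , reachable⇒settled reachable , Represents.owned⁺ rep y∈B

Built-mono : ∀ {n} {P : Rule n → Set} {p p′ inc τ κ} → p ≤ p′ → Built P p inc τ κ →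
             Built P p′ inc τ κ
Built-mono {τ = τ} p≤p′ built = record
  { counts = Counts-extend {τ = τ} p≤p′ unused counts
  ; unused = λ p′≤s → unused (ℕ.≤-trans p≤p′ p′≤s)
  ; bounded = λ zs∈ → ℕ.<-≤-trans (bounded zs∈) p≤p′ ; sound = sound ; complete = complete }
  where open Built built

-- Scanning the tape.

Linked-at : List (ℕ × ℕ) → State → Set
Linked-at inc s = Linked (arr s head) (arr s next) (arr s owner) inc (reg s pos)

Marked : ∀ {n} → Fin n → List (Fin n) → ℕ → Set
Marked q ys f = (f ≡ 0 × ¬ q ∈ˡ ys) ⊎ (f ≡ 1 × q ∈ˡ ys)

Linked-≡ : ∀ {η η′ ν ν′ ω ω′ inc p p′} → η′ ≡ η → ν′ ≡ ν → ω′ ≡ ω → p′ ≡ p →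
           Linked η ν ω inc p → Linked η′ ν′ ω′ inc p′
Linked-≡ refl refl refl refl linked = linked

Reads-≡ : ∀ u {f f′ p p′} → f′ ≡ f → p′ ≡ p → Reads f p u → Reads f′ p′ u
Reads-≡ u refl refl reads = reads

module _ {n} {q : Fin n} {inc : List (ℕ × ℕ)} where

  Scanned : List (Fin n) → State → Set
  Scanned ys s = Marked q ys (reg s flag) ×
                 Linked-at (map (λ y → toℕ y , reg s origin) ys ++ inc) s

  linkItem-run : ∀ {s x ys} → reg s item ≡ toℕ x → Marked q (x ∷ ys) (reg s flag) →
    Linked-at (map (λ y → toℕ y , reg s origin) ys ++ inc) s →
    Run linkItem s 6 (λ s′ → Scanned (x ∷ ys) s′ × reg s′ pos ≡ suc (reg s pos) ×
                             reg s′ left ≡ pred (reg s left))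
  linkItem-run {s} {x} {ys} item≡ marked linked = ▸ ▸ ▸ ▸ ▸ stop
    ((marked , subst (λ v → Linked _ _ _ ((v , reg s origin) ∷ _) _) item≡
                     (Linked-insert (reg s item) (reg s origin) linked)) , refl , refl)

  scanItem-run : ∀ {s x ys} → arr s tape (reg s pos) ≡ toℕ x → reg s target ≡ toℕ q → Scanned ys s →
    Run scanItem s 9 (λ s′ → Scanned (x ∷ ys) s′ × reg s′ pos ≡ suc (reg s pos) ×
                             reg s′ left ≡ pred (reg s left))
  scanItem-run {s} {x} {ys} tape≡ target≡ (marked , linked) = ▸ (mark ▹
    λ { trace (item≡ , marked′ , linked′) →
          refine (linkItem-run item≡ marked′ linked′) λ { _ (scanned , pos≡ , left≡) →
            scanned , trans pos≡ (cong suc (reg-frame pos trace refl)) ,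
                      trans left≡ (cong pred (reg-frame left trace refl)) } })
    where
    s₁ = perform (item ≔ tape [ pos ]) s

    mark : Run (cond (item == target) (exec (flag ≔const 1)) skip) s₁ 2 (λ s′ →
      reg s′ item ≡ toℕ x × Marked q (x ∷ ys) (reg s′ flag) ×
      Linked-at (map (λ y → toℕ y , reg s′ origin) ys ++ inc) s′)
    mark with q Fin.≟ x
    ... | Dec.yes refl = then-run (trans (cong₂ _≡ᵇ_ tape≡ target≡) (≡ᵇ-refl (toℕ q)))
      (stop (tape≡ , inj₂ (refl , here refl) , linked))
    ... | Dec.no q≢x = within (s≤s z≤n) (else-run
      (trans (cong₂ _≡ᵇ_ tape≡ target≡) (≢⇒≡ᵇ _ _ λ eq → q≢x (sym (Fin.toℕ-injective eq))))
      (halt (tape≡ , Sum.map (λ (f≡ , q∉) → f≡ , λ { (here q≡x) → q≢x q≡x ; (there q∈) → q∉ q∈ })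
                             (λ (f≡ , q∈) → f≡ , there q∈) marked , linked)))

  -- Nodes are inserted at the front as they are read, hence the reversed accumulation.
  scanItems-run : ∀ xs {s ys u} → reg s ground ≡ 0 → reg s target ≡ toℕ q → reg s left ≡ length xs →
    Reads (arr s tape) (reg s pos) (map toℕ xs ++ u) → Scanned ys s →
    Run (while (ground << left) scanItem) s (1 + 10 * length xs)
      (λ s′ → Scanned (xs ʳ++ ys) s′ × Reads (arr s′ tape) (reg s′ pos) u × reg s pos ≤ reg s′ pos)
  scanItems-run [] {s} z target≡ left≡ reads scanned =
    loop-end (not-positive {s} left z left≡) (scanned , reads , ℕ.≤-refl)
  scanItems-run (x ∷ xs) {s} {ys} {u} z target≡ left≡ (tape≡ , reads) scanned =
    within (ℕ.≤-reflexive (charge (length xs))) (loop-step (positive {s} left z left≡)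
      (scanItem-run tape≡ target≡ scanned)
      λ { trace (scanned′ , pos≡ , left≡′) →
        refine (scanItems-run xs (trans (reg-frame ground trace refl) z)
                 (trans (reg-frame target trace refl) target≡) (trans left≡′ (cong pred left≡))
                 (Reads-≡ (map toℕ xs ++ u) (arr-frame tape trace refl) pos≡ reads) scanned′)
          λ { _ (scanned″ , reads′ , pos≤) →
            scanned″ , reads′ , ℕ.<⇒≤ (subst (_≤ _) pos≡ pos≤) } })
    where
    charge : ∀ m → suc (9 + (1 + 10 * m)) ≡ 1 + 10 * suc m
    charge = solve-∀

-- Delete the listed elements from `A` one by one; uniqueness keeps the later ones in what is left.
-- This converts lengths on the tape into the cardinalities that `size` counts.
length-enumeration : ∀ {n} {xs : List (Fin n)} {A} → Unique xs → (∀ {x} → x ∈ˡ xs → x ∈ A) →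
                     length xs ≤ ∣ A ∣
length-enumeration [] _ = z≤n
length-enumeration {A = A} (x∉xs ∷ unique) xs⊆A = ℕ.≤-trans
  (s≤s (length-enumeration {A = A - _} unique λ y∈xs →
    Sub.x∈p∧x≢y⇒x∈p-y (xs⊆A (there y∈xs)) (All.lookup x∉xs y∈xs ∘ sym)))
  (Sub.x∈p⇒∣p-x∣<∣p∣ (xs⊆A (here refl)))

openRule-run : ∀ {n s p p′ inc B q} {P : Rule n → Set} →
  Built P p inc (arr s open-rule) (arr s count) → p < p′ →
  (ys : List (Fin n)) → (∀ y → y ∈ˡ ys ⇔ y ∈ B) → reg s origin ≡ p → reg s target ≡ toℕ q → q ∉ B →
  Run openRule s 5 (λ s′ → Built (λ r → r ≡ (B , q) ⊎ P r) p′ (map (λ y → toℕ y , p) ys ++ inc)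
                                 (arr s′ open-rule) (arr s′ count))
openRule-run built p<p′ ys ys⇔B origin≡ target≡ q∉B =
  ▸ ▸ ▸ ▸ stop (Built-open built p<p′ ys ys⇔B origin≡ target≡ q∉B)

-- The bound `b` on the number of nodes is what the time of the closure depends on.
record Stored {n} (P : Rule n → Set) (b : ℕ) (s : State) : Set where
  constructor stored
  field
    {inc}  : List (ℕ × ℕ)
    small  : length inc ≤ b
    linked : Linked-at inc s
    built  : Built P (reg s pos) inc (arr s open-rule) (arr s count)

scanRule-run : ∀ {n s B q v u b} {P : Rule n → Set} → EncodesRule v (B , q) → reg s ground ≡ 0 →
  Reads (arr s tape) (reg s pos) (v ++ u) → Stored P b s →
  Run scanRule s (14 + 10 * ∣ B ∣) (λ s′ →
    Stored (λ r → r ≡ (B , q) ⊎ P r) (∣ B ∣ + b) s′ × Reads (arr s′ tape) (reg s′ pos) u ×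
    reg s′ rules ≡ pred (reg s rules))
scanRule-run {n} {s} {B} {q} {u = u} {b} {P} (rule {xs} (unique , xs⇔B)) z (target≡ , left≡ , reads)
             (stored {inc} small linked built) =
  within (ℕ.≤-trans (ℕ.≤-reflexive (charge (length xs)))
            (ℕ.+-monoʳ-≤ 14 (ℕ.*-monoʳ-≤ 10 xs≤B)))
  (▸ ▸ ▸ ▸ ▸ ▸ (scanItems-run {q = q} {inc} xs z target≡ left≡ reads
     (inj₁ (refl , λ ()) , Linked-mono (ℕ.m≤n⇒m≤1+n (ℕ.n≤1+n _)) linked) ▹
  λ { {s′ = s′} trace ((marked , linked′) , reads′ , pos≤) →
    (conclude trace marked pos≤ ▹
    λ { {s′ = s″} trace′ built″ → stop
      ( stored length≤
          (Linked-≡ (arr-frame head trace′ refl) (arr-frame next trace′ refl)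
            (arr-frame owner trace′ refl) (reg-frame pos trace′ refl)
            (subst (λ o → Linked-at (map (λ y → toℕ y , o) ys ++ inc) s′)
              (reg-frame origin trace refl) linked′))
          (Built-mono (ℕ.≤-reflexive (sym (reg-frame pos trace′ refl))) built″)
      , Reads-≡ u (arr-frame tape trace′ refl) (reg-frame pos trace′ refl) reads′
      , cong pred (trans (reg-frame rules trace′ refl) (reg-frame rules trace refl))) }) }))
  where
  ys = xs ʳ++ []

  xs≤B : length xs ≤ ∣ B ∣
  xs≤B = length-enumeration unique λ {x} → to (xs⇔B x)

  length≤ : length (map (λ y → toℕ y , reg s pos) ys ++ inc) ≤ ∣ B ∣ + b
  length≤ = subst (_≤ ∣ B ∣ + b) (sym (trans (List.length-++ (map (λ y → toℕ y , reg s pos) ys))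
    (cong (_+ length inc) (trans (List.length-map _ ys) (List.length-reverse xs)))))
    (ℕ.+-mono-≤ xs≤B small)

  ys⇔B : ∀ y → y ∈ˡ ys ⇔ y ∈ B
  ys⇔B y = mk⇔ (to (xs⇔B y) ∘ Any.reverse⁻) (Any.reverse⁺ ∘ from (xs⇔B y))

  s₆ = perform (flag ≔const 0) (perform (pos ≔suc pos) (perform (left ≔ tape [ pos ])
         (perform (pos ≔suc pos) (perform (target ≔ tape [ pos ]) (perform (origin ≔ pos) s)))))

  -- Six instructions up to the loop, the loop itself, at most six steps for the conditional
  -- opening, and one to count down.
  charge : ∀ m → 6 + (1 + 10 * m + (6 + 1)) ≡ 14 + 10 * m
  charge = solve-∀

  conclude : ∀ {t s′} → ⟨ while (ground << left) scanItem , s₆ ⟩⇓[ t ] s′ →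
    Marked q ys (reg s′ flag) → suc (suc (reg s pos)) ≤ reg s′ pos →
    Run (cond (flag == ground) openRule skip) s′ 6 (λ s″ →
      Built (λ r → r ≡ (B , q) ⊎ P r) (reg s′ pos) (map (λ y → toℕ y , reg s pos) ys ++ inc)
            (arr s″ open-rule) (arr s″ count))
  conclude {s′ = s′} trace marked pos≤ = go marked
    where
    built′ : Built P (reg s pos) inc (arr s′ open-rule) (arr s′ count)
    built′ = subst₂ (Built P (reg s pos) inc)
      (sym (arr-frame open-rule trace refl)) (sym (arr-frame count trace refl)) built

    p<p′ : reg s pos < reg s′ pos
    p<p′ = ℕ.≤-trans (ℕ.n≤1+n _) pos≤

    z′ : reg s′ ground ≡ 0
    z′ = trans (reg-frame ground trace refl) z

    go : Marked q ys (reg s′ flag) → Run (cond (flag == ground) openRule skip) s′ 6 (λ s″ →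
      Built (λ r → r ≡ (B , q) ⊎ P r) (reg s′ pos) (map (λ y → toℕ y , reg s pos) ys ++ inc)
            (arr s″ open-rule) (arr s″ count))
    go (inj₁ (flag≡0 , q∉ys)) = then-run (is-zero {s′} flag z′ flag≡0)
      (openRule-run built′ p<p′ ys ys⇔B (reg-frame origin trace refl)
        (trans (reg-frame target trace refl) target≡) (q∉ys ∘ from (ys⇔B q)))
    go (inj₂ (flag≡1 , q∈ys)) = within (s≤s z≤n) (else-run (not-zero {s′} flag z′ flag≡1)
      (halt (Built-satisfied built′ p<p′ ys ys⇔B (to (ys⇔B q) q∈ys))))

Stored-⇔ : ∀ {n b b′ s} {P P′ : Rule n → Set} → b ≤ b′ → (∀ r → P r ⇔ P′ r) →
           Stored P b s → Stored P′ b′ s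
Stored-⇔ b≤b′ P⇔P′ (stored small linked built) =
  stored (ℕ.≤-trans small b≤b′) linked (Built-⇔ P⇔P′ built)

scanRules-run : ∀ {n s v u b R} {P : Rule n → Set} → EncodesRules v R → reg s ground ≡ 0 →
  reg s rules ≡ length R → Reads (arr s tape) (reg s pos) (v ++ u) → Stored P b s →
  Run (while (ground << rules) scanRule) s (1 + 15 * size R) (λ s′ →
    Stored (λ r → r ∈ˡ R ⊎ P r) (size R + b) s′ × Reads (arr s′ tape) (reg s′ pos) u)
scanRules-run {s = s} [] z rules≡ reads store = loop-end (not-positive {s} rules z rules≡)
  (Stored-⇔ ℕ.≤-refl (λ r → mk⇔ inj₂ λ { (inj₁ ()) ; (inj₂ Pr) → Pr }) store , reads)
scanRules-run {n} {s} {u = u} {b} {P = P} (_∷_ {u = u₁} {v₁} {r = B , q} {R} rule₁ rules₁)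
              z rules≡ reads store =
  -- A rule costs 15 steps, loop test included, and 10 per element of its body. Giving away 5 more
  -- per element makes this 15 times its contribution to `size`.
  within (ℕ.≤-trans (ℕ.m≤m+n _ (5 * ∣ B ∣)) (ℕ.≤-reflexive (charge ∣ B ∣ (size R))))
    (loop-step (positive {s} rules z rules≡)
      (scanRule-run rule₁ z (subst (Reads _ _) (List.++-assoc u₁ v₁ u) reads) store)
      λ { trace (store′ , reads′ , rules≡′) →
        refine (scanRules-run rules₁ (trans (reg-frame ground trace refl) z)
                 (trans rules≡′ (cong pred rules≡)) reads′ store′)
          λ _ (store″ , reads″) →
            Stored-⇔ (ℕ.≤-trans (ℕ.n≤1+n _) (ℕ.≤-reflexive (total (size R) ∣ B ∣ b)))
                     regroup store″ , reads″ })
  where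
  charge : ∀ m S → suc (14 + 10 * m + (1 + 15 * S)) + 5 * m ≡ 1 + 15 * (suc m + S)
  charge = solve-∀

  total : ∀ S m b → suc (S + (m + b)) ≡ suc m + S + b
  total = solve-∀

  regroup : ∀ r → (r ∈ˡ R ⊎ r ≡ (B , q) ⊎ P r) ⇔ (r ∈ˡ ((B , q) ∷ R) ⊎ P r)
  regroup r = mk⇔
    (λ { (inj₁ r∈R) → inj₁ (there r∈R) ; (inj₂ (inj₁ r≡)) → inj₁ (here r≡)
       ; (inj₂ (inj₂ Pr)) → inj₂ Pr })
    (λ { (inj₁ (here r≡)) → inj₂ (inj₁ r≡) ; (inj₁ (there r∈R)) → inj₁ r∈R
       ; (inj₂ Pr) → inj₂ (inj₂ Pr) })

-- The tape cell that lists `x` doubles as the position of the rule `(⊥ , x)`. With an empty body,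
-- the incidences are unchanged.
forbidItem-run : ∀ {n s x b} {P : Rule n → Set} → arr s tape (reg s pos) ≡ toℕ x → Stored P b s →
  Run forbidItem s 9 (λ s′ → Stored (λ r → r ≡ (⊥ , x) ⊎ P r) b s′ ×
    reg s′ pos ≡ suc (reg s pos) × reg s′ left ≡ pred (reg s left))
forbidItem-run {s = s} {x} tape≡ (stored small linked built) = ▸ ▸ ▸ ▸
  refine (openRule-run built ℕ.≤-refl [] (λ y → mk⇔ (λ ()) λ y∈⊥ → contradiction y∈⊥ Sub.∉⊥)
           refl tape≡ Sub.∉⊥)
    λ trace built′ → let pos≡ = reg-frame pos trace refl in
      stored small
        (Linked-≡ (arr-frame head trace refl) (arr-frame next trace refl)
          (arr-frame owner trace refl) pos≡ (Linked-mono (ℕ.n≤1+n _) linked))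
        (Built-mono (ℕ.≤-reflexive (sym pos≡)) built′)
    , pos≡ , reg-frame left trace refl

forbidItems-run : ∀ {n} xs {s b} {P : Rule n → Set} → reg s ground ≡ 0 → reg s left ≡ length xs →
  Reads (arr s tape) (reg s pos) (map toℕ xs) → Stored P b s →
  Run (while (ground << left) forbidItem) s (1 + 10 * length xs) (λ s′ →
    Stored (λ r → ∃[ x ] (x ∈ˡ xs × r ≡ (⊥ , x)) ⊎ P r) b s′)
forbidItems-run [] {s} z left≡ reads store = loop-end (not-positive {s} left z left≡)
  (Stored-⇔ ℕ.≤-refl (λ r → mk⇔ inj₂ λ { (inj₁ (_ , () , _)) ; (inj₂ Pr) → Pr }) store)
forbidItems-run (x ∷ xs) {s} {P = P} z left≡ (tape≡ , reads) store =
  within (ℕ.≤-reflexive (charge (length xs))) (loop-step (positive {s} left z left≡)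
    (forbidItem-run tape≡ store)
    λ { trace (store′ , pos≡ , left≡′) →
      refine (forbidItems-run xs (trans (reg-frame ground trace refl) z)
               (trans left≡′ (cong pred left≡))
               (Reads-≡ (map toℕ xs) (arr-frame tape trace refl) pos≡ reads) store′)
        λ _ → Stored-⇔ ℕ.≤-refl regroup })
  where
  charge : ∀ m → suc (9 + (1 + 10 * m)) ≡ 1 + 10 * suc m
  charge = solve-∀

  regroup : ∀ r → (∃[ y ] (y ∈ˡ xs × r ≡ (⊥ , y)) ⊎ r ≡ (⊥ , x) ⊎ P r) ⇔
                  (∃[ y ] (y ∈ˡ (x ∷ xs) × r ≡ (⊥ , y)) ⊎ P r)
  regroup r = mk⇔
    (λ { (inj₁ (y , y∈ , r≡)) → inj₁ (y , there y∈ , r≡)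
       ; (inj₂ (inj₁ r≡)) → inj₁ (x , here refl , r≡)
       ; (inj₂ (inj₂ Pr)) → inj₂ Pr })
    (λ { (inj₁ (y , here refl , r≡)) → inj₂ (inj₁ r≡)
       ; (inj₁ (y , there y∈ , r≡)) → inj₁ (y , y∈ , r≡)
       ; (inj₂ Pr) → inj₂ (inj₂ Pr) })

Stored-advance : ∀ {n} {P : Rule n → Set} {s b p} → reg s pos ≤ p → Stored P b s →
                 ∀ {s′} → arr s′ ≡ arr s → reg s′ pos ≡ p → Stored P b s′
Stored-advance pos≤p (stored small linked built) {state _ _} refl refl =
  stored small (Linked-mono pos≤p linked) (Built-mono pos≤p built)

Stored-initial : ∀ {n} w →
  let s = perform (pos ≔suc pos) (perform (rules ≔ tape [ pos ])
            (perform (pos ≔suc pos) (perform (size-n ≔ tape [ pos ]) (initial w))))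
  in Stored {n} (λ _ → Empty.⊥) 0 s
Stored-initial w = stored {inc = []} z≤n
  (record { chains = λ _ → [] ; fresh = λ _ → s≤s z≤n })
  (record { counts = λ _ → refl ; unused = λ _ → refl ; bounded = λ () ; sound = λ ()
          ; complete = λ () })

readInput-run : ∀ {n w R A} {q : Fin n} → EncodesInput w R (A , q) →
  Run readInput (initial w) (10 + (15 * size R + 10 * n)) (λ s →
    Stored (Constraint R A) (size R) s × reg s size-n ≡ n × reg s query ≡ toℕ q)
readInput-run {n} {w} {R} {A} {q} (input {u} {v} rules₁ (rule {xs} (unique , xs⇔A))) =
  within bound (▸ ▸ ▸ ▸
    (scanRules-run rules₁ refl refl (proj₂ (proj₂
      (Reads-word (word w) 0 w λ i → cong (word w) (ℕ.+-identityʳ i))))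
      (Stored-initial w) ▹
    λ { trace (store , query≡ , left≡ , reads) → ▸ ▸ ▸ ▸
      refine (forbidItems-run xs (reg-frame ground trace refl) left≡ reads
               (Stored-advance (ℕ.m≤n⇒m≤1+n (ℕ.n≤1+n _)) store refl refl))
        λ trace′ store′ →
          Stored-⇔ (ℕ.≤-reflexive (ℕ.+-identityʳ (size R))) regroup store′ ,
          trans (reg-frame size-n trace′ refl) (reg-frame size-n trace refl) ,
          trans (reg-frame query trace′ refl) query≡ }))
  where
  -- The body of the queried rule does not enter `size R`, so its length is charged to `n`.
  bound : 4 + (1 + 15 * size R + (4 + (1 + 10 * length xs))) ≤ 10 + (15 * size R + 10 * n)
  bound = ℕ.≤-trans (ℕ.≤-reflexive (charge (size R) (length xs)))
    (ℕ.+-monoʳ-≤ 10 (ℕ.+-monoʳ-≤ (15 * size R) (ℕ.*-monoʳ-≤ 10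
      (ℕ.≤-trans (length-enumeration unique λ {x} → to (xs⇔A x)) (Sub.∣p∣≤n A)))))
    where
    charge : ∀ S m → 4 + (1 + 15 * S + (4 + (1 + 10 * m))) ≡ 10 + (15 * S + 10 * m)
    charge = solve-∀

  regroup : ∀ r → (∃[ x ] (x ∈ˡ xs × r ≡ (⊥ , x)) ⊎ r ∈ˡ R ⊎ Empty.⊥) ⇔ Constraint R A r
  regroup r = mk⇔
    (λ { (inj₁ (x , x∈ , refl)) → forbid (to (xs⇔A x) x∈) ; (inj₂ (inj₁ r∈R)) → given r∈R
       ; (inj₂ (inj₂ ())) })
    (λ { (forbid {x} x∈A) → inj₁ (x , from (xs⇔A x) x∈A , refl) ; (given r∈R) → inj₂ (inj₁ r∈R) })

-- Deciding

saturate-run : ∀ {n s b} {P : Rule n → Set} → reg s ground ≡ 0 → reg s size-n ≡ n →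
  reg s top ≡ 0 → Stored P b s →
  Run saturate s (3 + (11 * n + 13 * b)) (λ s′ → ∀ x → arr s′ count (toℕ x) ≡ 0 ⇔ Reachable P x)
saturate-run {n} {s} {b} {P} z size≡ top≡ (stored {inc} small linked built) =
  within (ℕ.≤-reflexive (charge n b))
    (▸ pushZeros-run n (trans (ℕ.+-identityʳ n) (sym size≡)) z seeded ▹
    λ { trace (xs , zeros , stacked) →
      visit trace (subst (λ i → Zeros i _ xs) size≡ zeros) stacked })
  where
  τ = arr s open-rule
  open Closure n (reg s pos) τ inc (head<size built) (position<end built)
  open Seeding n (reg s pos) τ inc (head<size built) (position<end built)

  charge : ∀ n b → suc (1 + 6 * n + (1 + (5 * n + 13 * b))) ≡ 3 + (11 * n + 13 * b)
  charge = solve-∀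

  seeded : Seeded 0 (perform (target ≔const 0) s)
  seeded = [] , record { sound = [] ; complete = λ () ; balance = refl } ,
           subst (λ k → Stack (arr s stack) k []) (sym top≡) []

  visit : ∀ {t s′ xs} →
    ⟨ while (target << size-n) pushZero , perform (target ≔const 0) s ⟩⇓[ t ] s′ →
    Zeros n (arr s′ count) xs → Stack (arr s′ stack) (reg s′ top) xs →
    Run (while (ground << top) visitElement) s′ (1 + (5 * n + 13 * b))
        (λ s″ → ∀ x → arr s″ count (toℕ x) ≡ 0 ⇔ Reachable P x)
  visit {s′ = s′} {xs} trace zeros stacked = within
    (s≤s (subst (_≤ 5 * n + 13 * b) (sym balance)
      (ℕ.≤-trans (∑-weight n inc) (ℕ.+-monoʳ-≤ (5 * n) (ℕ.*-monoʳ-≤ 13 small)))))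
    (refine (visitElements-run (potential (arr s′ count) xs) ℕ.≤-refl
               (trans (reg-frame ground trace refl) z) chains inv stacked)
      λ _ inv′ x → mk⇔ (settled⇒reachable built ∘ zero⇒settled inv′)
                       (settled⇒zero inv′ ∘ reachable⇒settled built))
    where
    open Zeros zeros
    open Closing n (reg s pos) τ inc (head<size built) (position<end built)

    linked′ : Linked-at inc s′
    linked′ = Linked-≡ (arr-frame head trace refl) (arr-frame next trace refl)
      (arr-frame owner trace refl) (reg-frame pos trace refl) linked

    chains = Linked.chains linked′

    inv : Inv (arr s′ open-rule) (arr s′ count) xs []
    inv = subst (λ τ′ → Inv τ′ (arr s′ count) xs []) (sym (arr-frame open-rule trace refl))
      (Inv-start (subst (Counts (reg s pos) τ) (sym (arr-frame count trace refl))
                   (Built.counts built))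
                 complete sound)

answer-run : ∀ {s I} → reg s ground ≡ 0 → (arr s count (reg s query) ≡ 0 → ¬ I) →
  (arr s count (reg s query) ≢ 0 → I) → Run answer s 3 (λ s′ → Answers I (output s′))
answer-run {s} {I} z refutes proves = ▸ decide (arr s count (reg s query)) refl
  where
  s₁ = perform (temp ≔ count [ query ]) s

  decide : ∀ c → arr s count (reg s query) ≡ c →
           Run (cond (temp == ground) (exec (out ≔const 0)) (exec (out ≔const 1))) s₁ 2
               (λ s′ → Answers I (output s′))
  decide zero eq    = then-run (is-zero {s₁} temp z eq) (stop (no (refutes eq)))
  decide (suc c) eq = else-run (not-zero {s₁} temp z eq)
    (stop (yes (proves λ eq′ → ℕ.0≢1+n (trans (sym eq′) eq))))

decideImplicate-run : ∀ {n w R} {r : Rule n} → EncodesInput w R r →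
  Run decideImplicate (initial w) (16 + (28 * size R + 21 * n))
      (λ s → Answers (Implicate (𝓐 R) r) (output s))
decideImplicate-run {n} {w} {R} {A , q} encodes =
  within (ℕ.≤-reflexive (charge (size R) n)) (readInput-run encodes ▹
  λ { trace (store , size≡ , query≡) →
    let z = reg-frame ground trace refl in
    saturate-run z size≡ (reg-frame top trace refl) store ▹
  λ { {s′ = s′} trace′ spec →
    let query≡′ = trans (reg-frame query trace′ refl) query≡ in
    answer-run (trans (reg-frame ground trace′ refl) z)
      (λ zero → reachable⇒¬implicate R A
        (to (spec q) (subst (λ x → arr s′ count x ≡ 0) query≡′ zero)))
      (λ nonzero → ¬reachable⇒implicate R A λ reachable →
        nonzero (subst (λ x → arr s′ count x ≡ 0) (sym query≡′) (from (spec q) reachable))) } })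
  where
  charge : ∀ S n → 10 + (15 * S + 10 * n) + (3 + (11 * n + 13 * S) + 3) ≡ 16 + (28 * S + 21 * n)
  charge = solve-∀

Fin⇒1≤n : ∀ {n} → Fin n → 1 ≤ n
Fin⇒1≤n {suc n} _ = s≤s z≤n

theorem1p3 : ∃[ p ] ∃[ c ] ∀ (n : ℕ) (R : List (Rule n)) → Unique R → n ≤ size R →
    ∀ (r : Rule n) w → EncodesInput w R r →
    ∃[ t ] ∃[ s ] (⟨ p , initial w ⟩⇓[ t ] s × t ≤ c * size R ×
    Answers (Implicate (𝓐 R) r) (output s))
theorem1p3 = decideImplicate , 65 , λ n R _ n≤size r w encodes →
  let run trace bound answers = decideImplicate-run encodes
      -- The head of the queried rule makes the ground set nonempty, so `size R` is at least 1 and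
      -- absorbs the additive 16. Together with `n≤size` this gives 65 = 16 + 28 + 21.
      1≤size = ℕ.≤-trans (Fin⇒1≤n (proj₂ r)) n≤size
  in _ , _ , trace ,
     ℕ.≤-trans bound (ℕ.≤-trans
       (ℕ.+-mono-≤ (ℕ.*-monoʳ-≤ 16 1≤size) (ℕ.+-monoʳ-≤ (28 * size R) (ℕ.*-monoʳ-≤ 21 n≤size)))
       (ℕ.≤-reflexive (total (size R)))) ,
     answers
  where
  total : ∀ S → 16 * S + (28 * S + 21 * S) ≡ 65 * S
  total = solve-∀
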